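{- Let $(M_n)_{n\ge1}$, $M_n=(f_n(m,k))_{1\le m,k\le 2n}$, be the Delta sequence. Then, as formal power series in $x,y,z$, $$\sum_{n\ge1}\ \sum_{2\le m+1\le k\le 2n-1} f_n(m,k)\,\frac{x^{2n-k}}{(2n-k)!}\,\frac{y^{k-m-1}}{(k-m-1)!}\,\frac{z^{m-1}}{(m-1)!} =\frac{\sin(\sqrt2\,x)\,\sin(\sqrt2\,z)}{2\cos^2\!\big(\frac{x+y+z}{\sqrt2}\big)}.$$
   Context: Delta sequence. For $n\ge1$, $M_n=(f_n(m,k))_{1\le m,k\le 2n}$ is a $2n\times 2n$ matrix; by convention $f_n(m,k)=0$ if $(m,k)\notin[1,2n]^2$. Write $f_n(m,\bullet)=\sum_{k=1}^{2n}f_n(m,k)$ and $f_n(\bullet,k)=\sum_{m=1}^{2n}f_n(m,k)$. Let $L_n^{(1)}=\{(m,k):2\le k+1\le m\le 2n-2\}$ and $U_n^{(1)}=\{(m,k):2\le m+1\le k\le 2n-2\}$. The Delta sequence is the unique sequence $(M_n)_{n\ge1}$ of matrices with nonnegative integer entries such that $M_1=\begin{pmatrix}0&0\\1&0\end{pmatrix}$ and, for every $n\ge2$: (a) $f_n(m,m)=0$ for all $m$; (b) $f_n(m+2,k)-2f_n(m+1,k)+f_n(m,k)+2f_{n-1}(m,k)=0$ for $(m,k)\in L_n^{(1)}$; (c) $f_n(m,k+2)-2f_n(m,k+1)+f_n(m,k)+2f_{n-1}(m,k)=0$ for $(m,k)\in U_n^{(1)}$; (d) column $2n$ of $M_n$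 is zero, and column $2n-1$ is $(f_{n-1}(1,\bullet),\dots,f_{n-1}(2n-2,\bullet),0,0)$ read top to bottom; (e) row $2n$ of $M_n$ is $(f_{n-1}(1,\bullet),\dots,f_{n-1}(2n-2,\bullet),0,0)$ read left to right, and row $2n-1$ is $(f_{n-1}(1,\bullet)+f_{n-1}(\bullet,1),\dots,f_{n-1}(2n-2,\bullet)+f_{n-1}(\bullet,2n-2),0,0)$. (These conditions determine the sequence uniquely.) -}

module Defs where

open import Data.Bool using (Bool; true; false; not; if_then_else_; _∧_)
open import Data.Nat as ℕ using (ℕ; zero; suc; _≤_; _<_; _∸_; ⌊_/2⌋; _!; _≡ᵇ_; _≤ᵇ_)
open import Data.Nat.Properties using (_!≢0)
open import Data.Integer using (+_)
open import Data.Rational using (ℚ; _/_; _+_; _*_; -_; 0ℚ; 1ℚ)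
open import Data.Sum using (_⊎_)
open import Data.Product using (_×_)
open import Relation.Binary.PropositionalEquality using (_≡_)

sumℕ : ℕ → (ℕ → ℕ) → ℕ
sumℕ zero    g = 0
sumℕ (suc n) g = sumℕ n g ℕ.+ g n

sumℚ : ℕ → (ℕ → ℚ) → ℚ
sumℚ zero    g = 0ℚ
sumℚ (suc n) g = sumℚ n g + g n

-- Matrix sequences.  f n m k is the entry f_n(m,k) of M_n (1-based m,k).

Seq : Set
Seq = ℕ → ℕ → ℕ → ℕ

rowSum : Seq → ℕ → ℕ → ℕ
rowSum f n m = sumℕ (2 ℕ.* n) (λ i → f n m (suc i))

colSum : Seq → ℕ → ℕ → ℕ
colSum f n k = sumℕ (2 ℕ.* n) (λ i → f n (suc i) k)

record IsDelta (f : Seq) : Set where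
  field
    -- convention: f_n(m,k) = 0 outside [1,2n]^2
    outside : ∀ n m k → 1 ≤ n →
              (m ≡ 0 ⊎ k ≡ 0 ⊎ 2 ℕ.* n < m ⊎ 2 ℕ.* n < k) → f n m k ≡ 0
    init11 : f 1 1 1 ≡ 0
    init12 : f 1 1 2 ≡ 0
    init21 : f 1 2 1 ≡ 1
    init22 : f 1 2 2 ≡ 0
    diag : ∀ n → 2 ≤ n → ∀ m → f n m m ≡ 0
    recL : ∀ n → 2 ≤ n → ∀ m k → 1 ≤ k → suc k ≤ m → m ≤ 2 ℕ.* n ∸ 2 →
           f n (m ℕ.+ 2) k ℕ.+ f n m k ℕ.+ 2 ℕ.* f (n ∸ 1) m k
             ≡ 2 ℕ.* f n (m ℕ.+ 1) k
    recU : ∀ n → 2 ≤ n → ∀ m k → 1 ≤ m → suc m ≤ k → k ≤ 2 ℕ.* n ∸ 2 →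
           f n m (k ℕ.+ 2) ℕ.+ f n m k ℕ.+ 2 ℕ.* f (n ∸ 1) m k
             ≡ 2 ℕ.* f n m (k ℕ.+ 1)
    col2n   : ∀ n → 2 ≤ n → ∀ m → f n m (2 ℕ.* n) ≡ 0
    col2n-1 : ∀ n → 2 ≤ n → ∀ m → 1 ≤ m → m ≤ 2 ℕ.* n ∸ 2 →
              f n m (2 ℕ.* n ∸ 1) ≡ rowSum f (n ∸ 1) m
    col2n-1a : ∀ n → 2 ≤ n → f n (2 ℕ.* n ∸ 1) (2 ℕ.* n ∸ 1) ≡ 0
    col2n-1b : ∀ n → 2 ≤ n → f n (2 ℕ.* n) (2 ℕ.* n ∸ 1) ≡ 0
    row2n   : ∀ n → 2 ≤ n → ∀ k → 1 ≤ k → k ≤ 2 ℕ.* n ∸ 2 →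
              f n (2 ℕ.* n) k ≡ rowSum f (n ∸ 1) k
    row2na  : ∀ n → 2 ≤ n → f n (2 ℕ.* n) (2 ℕ.* n ∸ 1) ≡ 0
    row2nb  : ∀ n → 2 ≤ n → f n (2 ℕ.* n) (2 ℕ.* n) ≡ 0
    row2n-1 : ∀ n → 2 ≤ n → ∀ k → 1 ≤ k → k ≤ 2 ℕ.* n ∸ 2 →
              f n (2 ℕ.* n ∸ 1) k ≡ rowSum f (n ∸ 1) k ℕ.+ colSum f (n ∸ 1) k
    row2n-1a : ∀ n → 2 ≤ n → f n (2 ℕ.* n ∸ 1) (2 ℕ.* n ∸ 1) ≡ 0
    row2n-1b : ∀ n → 2 ≤ n → f n (2 ℕ.* n ∸ 1) (2 ℕ.* n) ≡ 0

-- Formal power series in x,y,z with rational coefficients: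
-- S a b c is the coefficient of x^a y^b z^c.

PS3 : Set
PS3 = ℕ → ℕ → ℕ → ℚ

_⊛_ : PS3 → PS3 → PS3
(F ⊛ G) a b c =
  sumℚ (suc a) λ i → sumℚ (suc b) λ j → sumℚ (suc c) λ l →
    F i j l * G (a ∸ i) (b ∸ j) (c ∸ l)

scale : ℚ → PS3 → PS3
scale q F a b c = q * F a b c

isEven : ℕ → Bool
isEven zero    = true
isEven (suc n) = not (isEven n)

invFact : ℕ → ℚ
invFact n = (+ 1 / (n !)) {{n !≢0}}

sgn : ℕ → ℚ
sgn i = if isEven i then 1ℚ else - 1ℚ

pow2 : ℕ → ℚ
pow2 i = + (2 ℕ.^ i) / 1

invPow2 : ℕ → ℚ
invPow2 zero    = 1ℚ
invPow2 (suc i) = (+ 1 / 2) * invPow2 i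

-- Left-hand side:  Σ_n Σ_{2 ≤ m+1 ≤ k ≤ 2n-1} f_n(m,k) x^{2n-k}/(2n-k)! y^{k-m-1}/(k-m-1)! z^{m-1}/(m-1)!.
-- The monomial x^a y^b z^c arises exactly from a = 2n-k, b = k-m-1, c = m-1,
-- i.e. m = c+1, k = b+c+2, 2n = a+b+c+2, and the range condition is a ≥ 1.
lhsSeries : Seq → PS3
lhsSeries f a b c =
  if (1 ≤ᵇ a) ∧ isEven (a ℕ.+ b ℕ.+ c)
  then (+ f ⌊ a ℕ.+ b ℕ.+ c ℕ.+ 2 /2⌋ (suc c) (b ℕ.+ c ℕ.+ 2) / 1)
         * invFact a * invFact b * invFact c
  else 0ℚ

-- sin(√2 x)/√2 = Σ_i (-1)^i 2^i x^{2i+1}/(2i+1)!   (coefficient of x^a)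
sinS2overS2 : ℕ → ℚ
sinS2overS2 a = if isEven a then 0ℚ else sgn ⌊ a /2⌋ * pow2 ⌊ a /2⌋ * invFact a

-- sin(√2 x) sin(√2 z) = 2 · (sin(√2 x)/√2) · (sin(√2 z)/√2)
numSeries : PS3
numSeries a b c =
  if b ≡ᵇ 0 then pow2 1 * sinS2overS2 a * sinS2overS2 c else 0ℚ

-- cos((x+y+z)/√2) = Σ_j (-1)^j (x+y+z)^{2j} / (2^j (2j)!),
-- whose coefficient of x^a y^b z^c (a+b+c = 2j) is (-1)^j/(2^j a! b! c!)
cosSeries : PS3
cosSeries a b c =
  if isEven (a ℕ.+ b ℕ.+ c)
  then sgn ⌊ a ℕ.+ b ℕ.+ c /2⌋ * invPow2 ⌊ a ℕ.+ b ℕ.+ c /2⌋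
         * invFact a * invFact b * invFact c
  else 0ℚ

denSeries : PS3
denSeries = scale (pow2 1) (cosSeries ⊛ cosSeries)

{-# OPTIONS --safe #-}

-- Write s(x) = sin(√2x)/√2, p(x) = (1 - cos √2x)/2, w = x + y + z, τ = √2 tan(w/√2) and
-- ν = ∂τ = 1/cos²(w/√2).  The upper and lower triangles of the Mₙ have exponential
-- generating functions U and L, and the conditions on the Delta sequence say that
-- (∂x - ∂y)² acts on both as multiplication by -2, with values and x-derivatives at x = 0
-- prescribed by the generating functions of the row and column sums of the previous
-- matrix, which are themselves integrals of U and L along antidiagonals.  By induction on
-- the degree this system has only one solution, and it is solved by U = s(x) s(z) ν and
--   L = (1 - 2p(x)) A + s(x) C,  A = 1 - 2p(z) + s(z) τ,  C = (1 - 2p(z)) τ - s(z) (2 - ν):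
-- the integrals have explicit primitives, and what remains are two trigonometric identities
-- at y = 0, which follow from ν (1 - p(w)) = 1, τ (1 - p(w)) = s(w) and the addition formulas.
module Submission where

open import Defs
open import Algebra.Bundles using (CommutativeRing)
open import Algebra.Solver.Ring.AlmostCommutativeRing using (fromCommutativeRing; _-Raw-AlmostCommutative⟶_; -raw-almostCommutative⟶)
import Algebra.Properties.Ring
import Algebra.Solver.Ring as RingSolver
open import Data.Bool using (true; false; not; if_then_else_)
open import Data.Integer as ℤ using (+_)
import Data.Integer.Properties as ℤₚ
open import Data.Maybe using (Maybe; just; nothing)
open import Data.Nat as ℕ using (ℕ; zero; suc; _<_; _≤_; z≤n; s≤s; ⌊_/2⌋; _∸_; _!)
import Data.Nat.Coprimality as Coprimality
import Data.Nat.Properties as ℕₚ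
open import Data.Nat.Solver using (module +-*-Solver)
open import Data.Product using (_×_; _,_; proj₁; proj₂)
open import Data.Rational as ℚ using (ℚ; 0ℚ; 1ℚ; ½; mkℚ)
import Data.Rational.Properties as ℚₚ
open import Data.Sum using (inj₁; inj₂)
open import Data.Unit using (⊤; tt)
open import Function using (case_of_)
open import Level using (0ℓ)
open import Algebra.Properties.Group ℚₚ.+-0-group using () renaming (∙-cancelʳ to +-cancelʳ)
open import Relation.Binary.PropositionalEquality as ≡ using (_≡_)
import Relation.Binary.Reasoning.Setoid as SetoidReasoning
open import Relation.Nullary using (yes; no)

-- The equation (∂x - ∂y)² F = -2 F has the general solution cos(√2x) α + s(x) β, with α and β
-- functions of x + y and z; at x = 0 the value of F is α and that of (∂x - ∂y) F is β. The boundary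
-- conditions therefore name the unknowns: for U, α = 0 and β is the generating function R of the
-- row sums; for L, ∂y α = R and β is that of the column sums, which is C. With R = s(z) ν this
-- determines A up to a function of z, and 1 - 2p(z) is the one for which A = 1 at x = y = 0, that
-- is, f_1(2,1) = 1 and f_n(2n,2n-1) = 0 afterwards. All factors √2 are absorbed into the
-- normalisation of the functions, so that every coefficient is rational. The basic trigonometric
-- relations are obtained not by comparing expansions but by showing that their defects solve a
-- homogeneous linear differential system with zero initial value. The variable y is the outermost
-- index: ∂y is then a shift of the index b, and on functions of x + y + z the derivatives along x
-- and z are the same shift.

-- Rational algebras and polynomial identities over them.

ℚring : CommutativeRing 0ℓ 0ℓ
ℚring = ℚₚ.+-*-commutativeRing

record ℚAlgebra : Set₁ where
  field
    commutativeRing : CommutativeRing 0ℓ 0ℓ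
    scalars : CommutativeRing.rawRing ℚring
                -Raw-AlmostCommutative⟶ fromCommutativeRing commutativeRing
  open CommutativeRing commutativeRing public
  open _-Raw-AlmostCommutative⟶_ scalars public

-- The coefficients are rationals at every level of the tower of series rings: their equality is
-- decidable, whereas equality of power series is not.
module Solver (R : ℚAlgebra) where
  private
    open ℚAlgebra R
    scalar≟ : (p q : ℚ) → Maybe (⟦ p ⟧ ≈ ⟦ q ⟧)
    scalar≟ p q with p ℚₚ.≟ q
    ... | yes ≡.refl = just refl
    ... | no _       = nothing
  open RingSolver (CommutativeRing.rawRing ℚring) (fromCommutativeRing commutativeRing) scalars scalar≟ public

-- Rings of exponential generating functions.

-- Exponential generating functions Σ F n xⁿ/n! over R; the product is the one
-- forced by the Leibniz rule, so no binomial coefficients occur.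
module Hurwitz (R : ℚAlgebra) where
  open ℚAlgebra R
  private module S = Solver R
  open S using (solve; _:=_; _:+_)
  open SetoidReasoning setoid

  H : Set
  H = ℕ → Carrier

  infix 4 _≋_
  infixl 6 _⊕_
  infixl 7 _⊙_

  -- A record rather than a bare function type, so that unification can recover the two series from
  -- an equality between them.
  record _≋_ (F G : H) : Set where
    constructor pointwise
    field at : ∀ n → F n ≈ G n
  open _≋_ public

  ∂ : H → H
  ∂ F n = F (suc n)

  _⊕_ _⊙_ : H → H → H
  (F ⊕ G) n = F n + G n
  (F ⊙ G) zero    = F 0 * G 0
  (F ⊙ G) (suc n) = (∂ F ⊙ G) n + (F ⊙ ∂ G) n

  ⊖_ : H → H
  (⊖ F) n = - F n

  const : Carrier → H
  const r zero    = r
  const r (suc n) = 0#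

  ⊙-cong : ∀ {F F′ G G′} → F ≋ F′ → G ≋ G′ → F ⊙ G ≋ F′ ⊙ G′
  ⊙-cong p q .at n = go n p q
    where
    go : ∀ n {F F′ G G′} → F ≋ F′ → G ≋ G′ → (F ⊙ G) n ≈ (F′ ⊙ G′) n
    go zero    p q = *-cong (at p 0) (at q 0)
    go (suc n) p q = +-cong (go n (pointwise λ m → at p (suc m)) q)
                            (go n p (pointwise λ m → at q (suc m)))

  private
    comm : ∀ n F G → (F ⊙ G) n ≈ (G ⊙ F) n
    comm zero    F G = *-comm _ _
    comm (suc n) F G = trans (+-cong (comm n (∂ F) G) (comm n F (∂ G))) (+-comm _ _)

    distribʳ′ : ∀ n F G K → ((G ⊕ K) ⊙ F) n ≈ (G ⊙ F) n + (K ⊙ F) n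
    distribʳ′ zero    F G K = distribʳ _ _ _
    distribʳ′ (suc n) F G K = begin
      ((∂ G ⊕ ∂ K) ⊙ F) n + ((G ⊕ K) ⊙ ∂ F) n
        ≈⟨ +-cong (distribʳ′ n F (∂ G) (∂ K)) (distribʳ′ n (∂ F) G K) ⟩
      ((∂ G ⊙ F) n + (∂ K ⊙ F) n) + ((G ⊙ ∂ F) n + (K ⊙ ∂ F) n)
        ≈⟨ solve 4 (λ a b c d → (a :+ b) :+ (c :+ d) := (a :+ c) :+ (b :+ d)) refl _ _ _ _ ⟩
      _ ∎

    distribˡ′ : ∀ n F G K → (F ⊙ (G ⊕ K)) n ≈ (F ⊙ G) n + (F ⊙ K) n
    distribˡ′ n F G K = begin
      (F ⊙ (G ⊕ K)) n         ≈⟨ comm n F (G ⊕ K) ⟩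
      ((G ⊕ K) ⊙ F) n         ≈⟨ distribʳ′ n F G K ⟩
      (G ⊙ F) n + (K ⊙ F) n   ≈⟨ +-cong (comm n G F) (comm n K F) ⟩
      (F ⊙ G) n + (F ⊙ K) n   ∎

    assoc : ∀ n F G K → ((F ⊙ G) ⊙ K) n ≈ (F ⊙ (G ⊙ K)) n
    assoc zero    F G K = *-assoc _ _ _
    assoc (suc n) F G K = begin
      ((∂ F ⊙ G ⊕ F ⊙ ∂ G) ⊙ K) n + ((F ⊙ G) ⊙ ∂ K) n
        ≈⟨ +-congʳ (distribʳ′ n K (∂ F ⊙ G) (F ⊙ ∂ G)) ⟩
      (((∂ F ⊙ G) ⊙ K) n + ((F ⊙ ∂ G) ⊙ K) n) + ((F ⊙ G) ⊙ ∂ K) n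
        ≈⟨ +-cong (+-cong (assoc n (∂ F) G K) (assoc n F (∂ G) K)) (assoc n F G (∂ K)) ⟩
      ((∂ F ⊙ (G ⊙ K)) n + (F ⊙ (∂ G ⊙ K)) n) + (F ⊙ (G ⊙ ∂ K)) n
        ≈⟨ +-assoc _ _ _ ⟩
      (∂ F ⊙ (G ⊙ K)) n + ((F ⊙ (∂ G ⊙ K)) n + (F ⊙ (G ⊙ ∂ K)) n)
        ≈⟨ +-congˡ (sym (distribˡ′ n F (∂ G ⊙ K) (G ⊙ ∂ K))) ⟩
      _ ∎

    zero⊙ : ∀ n F → ((λ _ → 0#) ⊙ F) n ≈ 0#
    zero⊙ zero    F = zeroˡ _
    zero⊙ (suc n) F = trans (+-cong (zero⊙ n F) (zero⊙ n (∂ F))) (+-identityˡ _)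

    const⊙′ : ∀ n r F → (const r ⊙ F) n ≈ r * F n
    const⊙′ zero    r F = refl
    const⊙′ (suc n) r F = trans (+-cong (zero⊙ n F) (const⊙′ n r (∂ F))) (+-identityˡ _)

    one⊙ : ∀ n F → (const 1# ⊙ F) n ≈ F n
    one⊙ n F = trans (const⊙′ n 1# F) (*-identityˡ _)

  hurwitzRing : CommutativeRing 0ℓ 0ℓ
  hurwitzRing = record
    { Carrier = H
    ; _≈_ = _≋_
    ; _+_ = _⊕_
    ; _*_ = _⊙_
    ; -_ = ⊖_
    ; 0# = λ _ → 0#
    ; 1# = const 1#
    ; isCommutativeRing = record
      { isRing = record
        { +-isAbelianGroup = record
          { isGroup = record
            { isMonoid = record
              { isSemigroup = record
                { isMagma = record
                  { isEquivalence = record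
                    { refl = pointwise λ _ → refl
                    ; sym = λ p → pointwise λ n → sym (at p n)
                    ; trans = λ p q → pointwise λ n → trans (at p n) (at q n)
                    }
                  ; ∙-cong = λ p q → pointwise λ n → +-cong (at p n) (at q n)
                  }
                ; assoc = λ F G K → pointwise λ n → +-assoc _ _ _
                }
              ; identity = (λ F → pointwise λ n → +-identityˡ _) , (λ F → pointwise λ n → +-identityʳ _)
              }
            ; inverse = (λ F → pointwise λ n → -‿inverseˡ _) , (λ F → pointwise λ n → -‿inverseʳ _)
            ; ⁻¹-cong = λ p → pointwise λ n → -‿cong (at p n)
            }
          ; comm = λ F G → pointwise λ n → +-comm _ _
          }
        ; *-cong = ⊙-cong
        ; *-assoc = λ F G K → pointwise λ n → assoc n F G K
        ; *-identity = (λ F → pointwise λ n → one⊙ n F)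
                     , (λ F → pointwise λ n → trans (comm n F (const 1#)) (one⊙ n F))
        ; distrib = (λ F G K → pointwise λ n → distribˡ′ n F G K)
                  , (λ F G K → pointwise λ n → distribʳ′ n F G K)
        }
      ; *-comm = λ F G → pointwise λ n → comm n F G
      }
    }

  const⊙ : ∀ r F → const r ⊙ F ≋ (λ n → r * F n)
  const⊙ r F = pointwise λ n → const⊙′ n r F

  algebra : ℚAlgebra
  algebra = record
    { commutativeRing = hurwitzRing
    ; scalars = record
      { ⟦_⟧    = λ p → const ⟦ p ⟧
      ; +-homo = λ p q → pointwise λ { zero → +-homo p q ; (suc n) → sym (+-identityˡ _) }
      ; *-homo = λ p q → pointwise λ { zero → *-homo p q
                                     ; (suc n) → sym (trans (const⊙′ (suc n) ⟦ p ⟧ (const ⟦ q ⟧)) (zeroʳ _)) }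
      ; -‿homo = λ p → pointwise λ { zero → -‿homo p ; (suc n) → sym -0#≈0# }
      ; 0-homo = pointwise λ { zero → 0-homo ; (suc n) → refl }
      ; 1-homo = pointwise λ { zero → 1-homo ; (suc n) → refl }
      }
    }
    where open Algebra.Properties.Ring (CommutativeRing.ring commutativeRing) using (-0#≈0#)

-- Derivations, Taylor expansion and linear differential equations.

2ℚ : ℚ
2ℚ = 1ℚ ℚ.+ 1ℚ

-- `𝟙` is the image of `1ℚ` and not the unit `1#`, which makes it the literal value of `con 1ℚ` in
-- the solver.
module Constants (R : ℚAlgebra) where
  open ℚAlgebra R
  𝟙 𝟚 : Carrier
  𝟙 = ⟦ 1ℚ ⟧
  𝟚 = ⟦ 2ℚ ⟧

record Derivation (R : ℚAlgebra) : Set where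
  open ℚAlgebra R
  field
    d        : Carrier → Carrier
    d-cong   : ∀ {x y} → x ≈ y → d x ≈ d y
    d-+      : ∀ x y → d (x + y) ≈ d x + d y
    d-neg    : ∀ x → d (- x) ≈ - d x
    d-*      : ∀ x y → d (x * y) ≈ d x * y + x * d y
    d-scalar : ∀ p → d ⟦ p ⟧ ≈ 0#

-- x ↦′ y records that y is the derivative of x, so that derivatives of compound
-- expressions are assembled by Agda and only then simplified.
module Differentiate (R : ℚAlgebra) (D : Derivation R) where
  open ℚAlgebra R
  open Derivation D

  infix 4 _↦′_
  record _↦′_ (x y : Carrier) : Set where
    constructor derives
    field derivative : d x ≈ y
  open _↦′_ public

  infixl 6 _⟨+⟩_ _⟨-⟩_
  infixl 7 _⟨*⟩_

  _⟨+⟩_ : ∀ {x x′ y y′} → x ↦′ x′ → y ↦′ y′ → x + y ↦′ x′ + y′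
  derives p ⟨+⟩ derives q = derives (trans (d-+ _ _) (+-cong p q))

  _⟨-⟩_ : ∀ {x x′ y y′} → x ↦′ x′ → y ↦′ y′ → x - y ↦′ x′ - y′
  derives p ⟨-⟩ derives q = derives (trans (d-+ _ _) (+-cong p (trans (d-neg _) (-‿cong q))))

  _⟨*⟩_ : ∀ {x x′ y y′} → x ↦′ x′ → y ↦′ y′ → x * y ↦′ x′ * y + x * y′
  derives p ⟨*⟩ derives q = derives (trans (d-* _ _) (+-cong (*-congʳ p) (*-congˡ q)))

  scalar : ∀ p → ⟦ p ⟧ ↦′ ⟦ 0ℚ ⟧
  scalar p = derives (trans (d-scalar p) (sym 0-homo))

  zero↦′ : ∀ {x} → d x ≈ 0# → x ↦′ ⟦ 0ℚ ⟧
  zero↦′ p = derives (trans p (sym 0-homo))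

module HurwitzCalculus (R : ℚAlgebra) where
  open ℚAlgebra R
  open Hurwitz R public
  private module A = ℚAlgebra algebra

  ∂-derivation : Derivation algebra
  ∂-derivation = record
    { d        = ∂
    ; d-cong   = λ p → pointwise λ n → at p (suc n)
    ; d-+      = λ _ _ → A.refl
    ; d-neg    = λ _ → A.refl
    ; d-*      = λ _ _ → A.refl
    ; d-scalar = λ _ → A.refl
    }

  module _ (D : Derivation R) where
    open Derivation D
    open SetoidReasoning setoid
    private
      d0 : d 0# ≈ 0#
      d0 = trans (d-cong (sym 0-homo)) (d-scalar 0ℚ)

      map-* : ∀ n F G → d ((F ⊙ G) n) ≈ ((λ m → d (F m)) ⊙ G) n + (F ⊙ (λ m → d (G m))) n
      map-* zero    F G = d-* _ _
      map-* (suc n) F G = begin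
        d ((∂ F ⊙ G) n + (F ⊙ ∂ G) n)
          ≈⟨ trans (d-+ _ _) (+-cong (map-* n (∂ F) G) (map-* n F (∂ G))) ⟩
        _ ≈⟨ solve 4 (λ a b c e → (a :+ b) :+ (c :+ e) := (a :+ c) :+ (b :+ e)) refl _ _ _ _ ⟩
        _ ∎
        where open Solver R using (solve; _:=_; _:+_)

    coefficientwise : Derivation algebra
    coefficientwise = record
      { d        = λ F n → d (F n)
      ; d-cong   = λ p → pointwise λ n → d-cong (at p n)
      ; d-+      = λ F G → pointwise λ n → d-+ _ _
      ; d-neg    = λ F → pointwise λ n → d-neg _
      ; d-*      = λ F G → pointwise λ n → map-* n F G
      ; d-scalar = λ p → pointwise λ { zero → d-scalar p ; (suc n) → d0 }
      }

    d-const : ∀ r → A._≈_ (λ n → d (const r n)) (const (d r))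
    d-const r = pointwise λ { zero → refl ; (suc n) → d0 }

    -- The Taylor homomorphism F(z) ↦ F(x + z).
    taylor : Carrier → H
    taylor r zero    = r
    taylor r (suc n) = taylor (d r) n

    taylor-cong : ∀ {r s} → r ≈ s → taylor r ≋ taylor s
    taylor-cong p .at n = go n p
      where
      go : ∀ n {r s} → r ≈ s → taylor r n ≈ taylor s n
      go zero    p = p
      go (suc n) p = go n (d-cong p)

    taylor-+ : ∀ r s → taylor (r + s) ≋ taylor r ⊕ taylor s
    taylor-+ r s .at n = go n r s
      where
      go : ∀ n r s → taylor (r + s) n ≈ taylor r n + taylor s n
      go zero    r s = refl
      go (suc n) r s = trans (at (taylor-cong (d-+ r s)) n) (go n (d r) (d s))

    -- `∂ (taylor r)` unfolds to `taylor (d r)`, so the Leibniz rule for `d` is exactly the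
    -- recursion that defines `_⊙_`.
    taylor-* : ∀ r s → taylor (r * s) ≋ taylor r ⊙ taylor s
    taylor-* r s .at n = go n r s
      where
      go : ∀ n r s → taylor (r * s) n ≈ (taylor r ⊙ taylor s) n
      go zero    r s = refl
      go (suc n) r s = trans (at (taylor-cong (d-* r s)) n)
        (trans (at (taylor-+ (d r * s) (r * d s)) n) (+-cong (go n (d r) s) (go n r (d s))))

    taylor-scalar : ∀ p → taylor ⟦ p ⟧ ≋ const ⟦ p ⟧
    taylor-scalar p .at zero    = refl
    taylor-scalar p .at (suc n) = trans (at (taylor-cong (d-scalar p)) n) (go n)
      where
      go : ∀ n → taylor 0# n ≈ 0#
      go zero    = refl
      go (suc n) = trans (at (taylor-cong d0) n) (go n)

    -- As `∂ (taylor r)` is `taylor (d r)` by definition, this says that the two partial derivatives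
    -- agree on functions of x + z.
    d-taylor : ∀ r → A._≈_ (λ n → d (taylor r n)) (taylor (d r))
    d-taylor r .at n = go n r
      where
      go : ∀ n r → d (taylor r n) ≈ taylor (d r) n
      go zero    r = refl
      go (suc n) r = go n (d r)

  VanishesUpTo : ℕ → H → Set
  VanishesUpTo n F = ∀ m → m ≤ n → F m ≈ 0#

  vanishes-⊕ : ∀ {n F G} → VanishesUpTo n F → VanishesUpTo n G → VanishesUpTo n (F ⊕ G)
  vanishes-⊕ p q m m≤n = trans (+-cong (p m m≤n) (q m m≤n)) (+-identityˡ _)

  vanishes-⊙ : ∀ {n F} G → VanishesUpTo n F → VanishesUpTo n (G ⊙ F)
  vanishes-⊙ G p m m≤n = go m G _ (λ k k≤m → p k (ℕₚ.≤-trans k≤m m≤n))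
    where
    go : ∀ m G F → VanishesUpTo m F → (G ⊙ F) m ≈ 0#
    go zero    G F p = trans (*-congˡ (p 0 z≤n)) (zeroʳ _)
    go (suc m) G F p = trans
      (+-cong (go m (∂ G) F (λ k k≤m → p k (ℕₚ.m≤n⇒m≤1+n k≤m)))
              (go m G (∂ F) (λ k k≤m → p (suc k) (s≤s k≤m))))
      (+-identityˡ _)

  vanishes-resp : ∀ {n F G} → F ≋ G → VanishesUpTo n G → VanishesUpTo n F
  vanishes-resp p q m m≤n = trans (at p m) (q m m≤n)

  -- For a system ∂F = M F the coefficients of F of order n + 1 are those of M F of order n, which
  -- involve F only up to order n. The matrix M enters only through this consequence, `step`.
  linear-ode-unique : {I : Set} (F : I → H) → (∀ i → F i 0 ≈ 0#) →
    (∀ n → (∀ i → VanishesUpTo n (F i)) → ∀ i → VanishesUpTo n (∂ (F i))) →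
    ∀ i → F i ≋ (λ _ → 0#)
  linear-ode-unique F init step i .at n = go n i n ℕₚ.≤-refl
    where
    go : ∀ n i → VanishesUpTo n (F i)
    go zero    i zero    _         = init i
    go (suc n) i zero    _         = init i
    go (suc n) i (suc m) (s≤s m≤n) = step n (go n) i m m≤n

-- Half-angle relations, addition formulas and the two identities at y = 0.

module Differences (R : ℚAlgebra) where
  open ℚAlgebra R
  open Solver R using (solve; _:=_; _:+_; _:-_)

  difference≈0 : ∀ {x y} → x ≈ y → x - y ≈ 0#
  difference≈0 {y = y} p = trans (+-congʳ p) (-‿inverseʳ y)

  difference≈0⁻¹ : ∀ {x y} → x - y ≈ 0# → x ≈ y
  difference≈0⁻¹ {x} {y} p = trans (solve 2 (λ x y → x := x :- y :+ y) refl x y)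
    (trans (+-congʳ p) (+-identityˡ y))

  -- Together with `_⊞_` this evaluates certificates: an element that the solver has written as a
  -- combination of differences of known equalities is zero.
  multiple≈0 : ∀ k {x y} → x ≈ y → k * (x - y) ≈ 0#
  multiple≈0 k p = trans (*-congˡ (difference≈0 p)) (zeroʳ k)

  infixl 6 _⊞_
  _⊞_ : ∀ {x y} → x ≈ 0# → y ≈ 0# → x + y ≈ 0#
  p ⊞ q = trans (+-cong p q) (+-identityˡ _)

-- Half-angle relations, with Z = (1 - cos 2φ)/2, σ = √½ sin 2φ, τ = √2 tan φ and ν = 1/cos² φ.
module HalfAngle (R : ℚAlgebra) where
  open ℚAlgebra R
  open Constants R

  record HalfAngle (τ ν σ Z : Carrier) : Set where
    field
      ν-inverse : ν * (𝟙 - Z) ≈ 𝟙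
      τ-ratio   : τ * (𝟙 - Z) ≈ σ
      Z-double  : Z + Z ≈ τ * σ

module HalfAngleODE (R : ℚAlgebra) where
  open ℚAlgebra R using (_≈_; 0#)
  open HurwitzCalculus R
  open HalfAngle R using () renaming (HalfAngle to HalfAngle₀)
  open HalfAngle algebra
  private module A = ℚAlgebra algebra
  open A using (_+_; _*_; _-_; -_) renaming (_≈_ to _≈ᴴ_)
  open Constants algebra
  open Solver algebra using (solve; _:=_; _:+_; _:*_; _:-_; :-_; con)
  open Differentiate algebra ∂-derivation
  open Differences R using (difference≈0)
  open Differences algebra using (difference≈0⁻¹)

  private
    data Relations : Set where
      inverse ratio double : Relations

  -- No single relation has a defect that is closed under differentiation, but the derivatives of
  -- the three defects are linear combinations of the three. Working over any `R` lets the result be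
  -- used twice: for one variable over ℚ, and then in x over series in z, where the one-variable
  -- case supplies the initial values.
  halfAngle-ode : ∀ {τ ν σ Z} →
    τ ↦′ ν → ν ↦′ τ * ν → σ ↦′ 𝟙 - (Z + Z) → Z ↦′ σ →
    HalfAngle₀ (τ 0) (ν 0) (σ 0) (Z 0) → HalfAngle τ ν σ Z
  halfAngle-ode {τ} {ν} {σ} {Z} τ′ ν′ σ′ Z′ init = record
    { ν-inverse = difference≈0⁻¹ (vanish inverse)
    ; τ-ratio   = difference≈0⁻¹ (vanish ratio)
    ; Z-double  = difference≈0⁻¹ (vanish double)
    }
    where
    open HalfAngle.HalfAngle init
    F : Relations → H
    F inverse = ν * (𝟙 - Z) - 𝟙
    F ratio   = τ * (𝟙 - Z) - σ
    F double  = (Z + Z) - τ * σ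

    F₀ : ∀ i → F i 0 ≈ 0#
    F₀ inverse = difference≈0 ν-inverse
    F₀ ratio   = difference≈0 τ-ratio
    F₀ double  = difference≈0 Z-double

    F′ : Relations → H
    F′ inverse = ν * F ratio
    F′ ratio   = 𝟙 * F inverse + 𝟙 * F double
    F′ double  = (ν - 𝟚) * F ratio + (- τ) * F inverse

    ∂F : ∀ i → ∂ (F i) ≈ᴴ F′ i
    ∂F inverse = A.trans (derivative (ν′ ⟨*⟩ (scalar 1ℚ ⟨-⟩ Z′) ⟨-⟩ scalar 1ℚ))
      (solve 4 (λ τ ν σ Z →
         τ :* ν :* (con 1ℚ :- Z) :+ ν :* (con 0ℚ :- σ) :- con 0ℚ
         := ν :* (τ :* (con 1ℚ :- Z) :- σ)) A.refl τ ν σ Z)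
    ∂F ratio = A.trans (derivative (τ′ ⟨*⟩ (scalar 1ℚ ⟨-⟩ Z′) ⟨-⟩ σ′))
      (solve 4 (λ τ ν σ Z →
         ν :* (con 1ℚ :- Z) :+ τ :* (con 0ℚ :- σ) :- (con 1ℚ :- (Z :+ Z))
         := con 1ℚ :* (ν :* (con 1ℚ :- Z) :- con 1ℚ) :+ con 1ℚ :* (Z :+ Z :- τ :* σ)) A.refl τ ν σ Z)
    ∂F double = A.trans (derivative (Z′ ⟨+⟩ Z′ ⟨-⟩ τ′ ⟨*⟩ σ′))
      (solve 4 (λ τ ν σ Z →
         σ :+ σ :- (ν :* σ :+ τ :* (con 1ℚ :- (Z :+ Z)))
         := (ν :- con 2ℚ) :* (τ :* (con 1ℚ :- Z) :- σ)
            :+ :- τ :* (ν :* (con 1ℚ :- Z) :- con 1ℚ)) A.refl τ ν σ Z)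

    F′-vanishes : ∀ n → (∀ i → VanishesUpTo n (F i)) → ∀ i → VanishesUpTo n (F′ i)
    F′-vanishes n v inverse = vanishes-⊙ ν (v ratio)
    F′-vanishes n v ratio   = vanishes-⊕ {F = 𝟙 * F inverse} (vanishes-⊙ 𝟙 (v inverse)) (vanishes-⊙ 𝟙 (v double))
    F′-vanishes n v double  = vanishes-⊕ {F = (ν - 𝟚) * F ratio} (vanishes-⊙ (ν - 𝟚) (v ratio)) (vanishes-⊙ (- τ) (v inverse))

    vanish : ∀ i → F i ≈ᴴ (λ _ → 0#)
    vanish = linear-ode-unique F F₀ (λ n v i → vanishes-resp (∂F i) (F′-vanishes n v i))

-- Here (s, p) and (t, q) are (√½ sin √2x, (1 - cos √2x)/2) for the two summands of an angle;
-- e, τ, ν stand for y-derivatives of 1, √2 tan(w/√2) and 1/cos²(w/√2), where w = x + y + z.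
module AdditionFormulas (R : ℚAlgebra) where
  open ℚAlgebra R
  open Constants R
  open HalfAngle R
  open Differences R
  open Solver R using (solve; _:=_; _:+_; _:*_; _:-_; con)

  -- The right-hand sides of the addition formulas, used in place of the functions of the summed
  -- angle: they satisfy the same differential equations, which is all that `HalfAngle` asks for.
  sinSum versSum : (s p t q : Carrier) → Carrier
  sinSum  s p t q = s * (𝟙 - (q + q)) + (𝟙 - (p + p)) * t
  versSum s p t q = p + q - (p * q + p * q) + s * t

  -- `wave` is the general solution of (∂x - ∂y)² F = -2 F, for α and β depending on x and y through
  -- x + y. In `integral` the factors 1 - 2p and s are replaced by their antiderivatives s and p,
  -- which vanish at x = 0.
  wave integral : (s p α β : Carrier) → Carrier
  wave     s p α β = (𝟙 - (p + p)) * α + s * β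
  integral s p α β = s * α + p * β

  -- The constant 1 is passed as `e` so that the same formulas give all y-derivatives of A and C.
  -- The integrals again replace 1 - 2q and t by t and q, now antiderivatives in z.
  A C ∫A ∫C : (t q e τ ν : Carrier) → Carrier
  A  t q e τ ν = (𝟙 - (q + q)) * e + t * τ
  C  t q e τ ν = (𝟙 - (q + q)) * τ - t * (𝟚 * e - ν)
  ∫A t q e τ ν = t * e + q * τ
  ∫C t q e τ ν = t * τ - q * (𝟚 * e - ν)

  module _ {s p t q e τ ν : Carrier} (e≈𝟙 : e ≈ 𝟙)
           (h : HalfAngle τ ν (sinSum s p t q) (versSum s p t q)) where
    open HalfAngle.HalfAngle h

    rowIdentity : s * s ≈ p + p - (p * p + p * p) →
      t * ν ≈ wave s p (∫A t q e τ ν) (∫C t q e τ ν) + integral s p ⟦ 0ℚ ⟧ (t * ν)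
    rowIdentity pyth = sym (difference≈0⁻¹ (trans
      (solve 7 (λ s p t q e τ ν →
        let σ = s :* (con 1ℚ :- (q :+ q)) :+ (con 1ℚ :- (p :+ p)) :* t
            Z = p :+ q :- (p :* q :+ p :* q) :+ s :* t
            w₁ = ν :* (con 1ℚ :- Z) :- con 1ℚ
            w₂ = τ :* (con 1ℚ :- Z) :- σ
            E = λ e → ((con 1ℚ :- (p :+ p)) :* (t :* e :+ q :* τ) :+ s :* (t :* τ :- q :* (con 2ℚ :* e :- ν)))
                :+ (s :* con 0ℚ :+ p :* (t :* ν)) :- t :* ν
        -- At e = 1 the defect E is linear in τ and ν. Multiplying by 1 - Z turns τ into σ and ν
        -- into 1 up to `w₂` and `w₁`, and what remains is t times the Pythagorean defect;
        -- multiplying by ν and using ν (1 - Z) = 1 recovers E. The multipliers of `w₁` and `w₂` are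
        -- thus read off from the coefficients of ν and τ in E. The column identity arises in the
        -- same way, with the Pythagorean relation for t and q.
        in E e := (ν :* (s :* q :- t :* (con 1ℚ :- p)) :- E (con 1ℚ)) :* w₁
                :+ ν :* ((con 1ℚ :- (p :+ p)) :* q :+ s :* t) :* w₂
                :+ ν :* t :* (s :* s :- (p :+ p :- (p :* p :+ p :* p)))
                :+ ((con 1ℚ :- (p :+ p)) :* t :- con 2ℚ :* s :* q) :* (e :- con 1ℚ))
        refl s p t q e τ ν)
      (multiple≈0 _ ν-inverse ⊞ multiple≈0 _ τ-ratio ⊞ multiple≈0 _ pyth ⊞ multiple≈0 _ e≈𝟙)))

    columnIdentity : t * t ≈ q + q - (q * q + q * q) →
      C t q e τ ν ≈ wave s p ⟦ 0ℚ ⟧ (q * ν) + integral s p (A t q e τ ν) (C t q e τ ν)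
    columnIdentity pyth = difference≈0⁻¹ (trans
      (solve 7 (λ s p t q e τ ν →
        let σ = s :* (con 1ℚ :- (q :+ q)) :+ (con 1ℚ :- (p :+ p)) :* t
            Z = p :+ q :- (p :* q :+ p :* q) :+ s :* t
            w₁ = ν :* (con 1ℚ :- Z) :- con 1ℚ
            w₂ = τ :* (con 1ℚ :- Z) :- σ
            A′ = λ e → (con 1ℚ :- (q :+ q)) :* e :+ t :* τ
            C′ = λ e → (con 1ℚ :- (q :+ q)) :* τ :- t :* (con 2ℚ :* e :- ν)
            E = λ e → C′ e :- (((con 1ℚ :- (p :+ p)) :* con 0ℚ :+ s :* (q :* ν)) :+ (s :* A′ e :+ p :* C′ e))
        in E e := (ν :* ((con 1ℚ :- p) :* t :- s :* q) :- E (con 1ℚ)) :* w₁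
                :+ ν :* ((con 1ℚ :- p) :* (con 1ℚ :- (q :+ q)) :- s :* t) :* w₂
                :+ ν :* s :* (t :* t :- (q :+ q :- (q :* q :+ q :* q)))
                :+ (con 2ℚ :* t :* (p :- con 1ℚ) :- s :* (con 1ℚ :- (q :+ q))) :* (e :- con 1ℚ))
        refl s p t q e τ ν)
      (multiple≈0 _ ν-inverse ⊞ multiple≈0 _ τ-ratio ⊞ multiple≈0 _ pyth ⊞ multiple≈0 _ e≈𝟙))

-- Derivatives of waves and of their primitives.

module Waves (R : ℚAlgebra) (D : Derivation R) where
  open ℚAlgebra R
  open Constants R
  open AdditionFormulas R
  open Solver R using (solve; _:=_; _:+_; _:*_; _:-_; :-_; con)
  open Derivation D
  open Differentiate R D

  module Along {s p : Carrier} (s′ : s ↦′ 𝟙 - (p + p)) (p′ : p ↦′ s) where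

    -- Splits ∂x as (∂x - ∂y) + ∂y: the first part acts only on the trigonometric factors and
    -- rotates (α, β) to (β, -2α), the second acts only on α and β.
    wave-derivative : ∀ {α α⁺ β β⁺} → α ↦′ α⁺ → β ↦′ β⁺ →
      d (wave s p α β) ≈ wave s p β (- (𝟚 * α)) + wave s p α⁺ β⁺
    wave-derivative {α} {α⁺} {β} {β⁺} α′ β′ = trans
      (derivative ((scalar 1ℚ ⟨-⟩ (p′ ⟨+⟩ p′)) ⟨*⟩ α′ ⟨+⟩ s′ ⟨*⟩ β′))
      (solve 6 (λ s p α α⁺ β β⁺ →
         ((con 0ℚ :- (s :+ s)) :* α :+ (con 1ℚ :- (p :+ p)) :* α⁺)
           :+ ((con 1ℚ :- (p :+ p)) :* β :+ s :* β⁺)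
         := ((con 1ℚ :- (p :+ p)) :* β :+ s :* (:- (con 2ℚ :* α)))
           :+ ((con 1ℚ :- (p :+ p)) :* α⁺ :+ s :* β⁺)) refl s p α α⁺ β β⁺)

    -- The rotation (α, β) ↦ (β, -2α) commutes with the y-derivative and its square is -2, whence
    -- (∂x - ∂y)² = -2.
    wave-equation : ∀ {α α⁺ α⁺⁺ β β⁺ β⁺⁺} → α ↦′ α⁺ → α⁺ ↦′ α⁺⁺ → β ↦′ β⁺ → β⁺ ↦′ β⁺⁺ →
      d (d (wave s p α β)) + wave s p α⁺⁺ β⁺⁺ + 𝟚 * wave s p α β ≈ 𝟚 * d (wave s p α⁺ β⁺)
    wave-equation {α} {α⁺} {α⁺⁺} {β} {β⁺} {β⁺⁺} α′ α″ β′ β″ = trans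
      (+-congʳ (+-congʳ (trans (d-cong (wave-derivative α′ β′)) (trans (d-+ _ _)
        (+-cong (wave-derivative β′ -2α′) (wave-derivative α″ β″))))))
      (trans
        (solve 8 (λ s p α α⁺ α⁺⁺ β β⁺ β⁺⁺ →
          let w = λ a b → (con 1ℚ :- (p :+ p)) :* a :+ s :* b in
          ((w (:- (con 2ℚ :* α)) (:- (con 2ℚ :* β)) :+ w β⁺ (:- (con 2ℚ :* α⁺)))
            :+ (w β⁺ (:- (con 2ℚ :* α⁺)) :+ w α⁺⁺ β⁺⁺)) :+ w α⁺⁺ β⁺⁺ :+ con 2ℚ :* w α β
          := con 2ℚ :* (w β⁺ (:- (con 2ℚ :* α⁺)) :+ w α⁺⁺ β⁺⁺)) refl s p α α⁺ α⁺⁺ β β⁺ β⁺⁺)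
        (*-congˡ (sym (wave-derivative α″ β″))))
      where
      -2α′ : - (𝟚 * α) ↦′ - (𝟚 * α⁺)
      -2α′ = derives (trans (d-neg _) (-‿cong (trans (derivative (scalar 2ℚ ⟨*⟩ α′))
        (solve 2 (λ α α⁺ → con 0ℚ :* α :+ con 2ℚ :* α⁺ := con 2ℚ :* α⁺) refl α α⁺))))

    -- `integral` is a primitive for ∂x - ∂y, not for ∂x; the remaining term with y-shifted
    -- arguments is what telescopes along antidiagonals.
    integral-derivative : ∀ {α α⁺ β β⁺} → α ↦′ α⁺ → β ↦′ β⁺ →
      d (integral s p α β) ≈ wave s p α β + integral s p α⁺ β⁺
    integral-derivative {α} {α⁺} {β} {β⁺} α′ β′ = trans
      (derivative (s′ ⟨*⟩ α′ ⟨+⟩ p′ ⟨*⟩ β′))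
      (solve 6 (λ s p α α⁺ β β⁺ →
         ((con 1ℚ :- (p :+ p)) :* α :+ s :* α⁺) :+ (s :* β :+ p :* β⁺)
         := ((con 1ℚ :- (p :+ p)) :* α :+ s :* β) :+ (s :* α⁺ :+ p :* β⁺)) refl s p α α⁺ β β⁺)

  module Across {s p : Carrier} (s′ : s ↦′ ⟦ 0ℚ ⟧) (p′ : p ↦′ ⟦ 0ℚ ⟧) where

    wave-split : ∀ {α α₁ α₂ β β₁ β₂} → α ↦′ α₁ + α₂ → β ↦′ β₁ + β₂ →
      d (wave s p α β) ≈ wave s p α₁ β₁ + wave s p α₂ β₂
    wave-split {α} {α₁} {α₂} {β} {β₁} {β₂} α′ β′ = trans
      (derivative ((scalar 1ℚ ⟨-⟩ (p′ ⟨+⟩ p′)) ⟨*⟩ α′ ⟨+⟩ s′ ⟨*⟩ β′))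
      (solve 8 (λ s p α α₁ α₂ β β₁ β₂ →
         ((con 0ℚ :- (con 0ℚ :+ con 0ℚ)) :* α :+ (con 1ℚ :- (p :+ p)) :* (α₁ :+ α₂))
           :+ (con 0ℚ :* β :+ s :* (β₁ :+ β₂))
         := ((con 1ℚ :- (p :+ p)) :* α₁ :+ s :* β₁)
           :+ ((con 1ℚ :- (p :+ p)) :* α₂ :+ s :* β₂)) refl s p α α₁ α₂ β β₁ β₂)

  -- A superscript + marks ∂/∂y, which agrees with ∂/∂x and ∂/∂z on functions of x + y + z.
  module Raise {e e⁺ τ τ⁺ ν ν⁺ : Carrier} (e′ : e ↦′ e⁺) (τ′ : τ ↦′ τ⁺) (ν′ : ν ↦′ ν⁺) where

    module Fixed {t q : Carrier} (t′ : t ↦′ ⟦ 0ℚ ⟧) (q′ : q ↦′ ⟦ 0ℚ ⟧) where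

      A′ : A t q e τ ν ↦′ A t q e⁺ τ⁺ ν⁺
      A′ = derives (trans (derivative ((scalar 1ℚ ⟨-⟩ (q′ ⟨+⟩ q′)) ⟨*⟩ e′ ⟨+⟩ t′ ⟨*⟩ τ′))
        (solve 6 (λ t q e e⁺ τ τ⁺ →
          ((con 0ℚ :- (con 0ℚ :+ con 0ℚ)) :* e :+ (con 1ℚ :- (q :+ q)) :* e⁺) :+ (con 0ℚ :* τ :+ t :* τ⁺)
          := (con 1ℚ :- (q :+ q)) :* e⁺ :+ t :* τ⁺) refl t q e e⁺ τ τ⁺))

      C′ : C t q e τ ν ↦′ C t q e⁺ τ⁺ ν⁺
      C′ = derives (trans
        (derivative ((scalar 1ℚ ⟨-⟩ (q′ ⟨+⟩ q′)) ⟨*⟩ τ′ ⟨-⟩ t′ ⟨*⟩ (scalar 2ℚ ⟨*⟩ e′ ⟨-⟩ ν′)))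
        (solve 8 (λ t q e e⁺ τ τ⁺ ν ν⁺ →
          ((con 0ℚ :- (con 0ℚ :+ con 0ℚ)) :* τ :+ (con 1ℚ :- (q :+ q)) :* τ⁺)
            :- (con 0ℚ :* (con 2ℚ :* e :- ν) :+ t :* ((con 0ℚ :* e :+ con 2ℚ :* e⁺) :- ν⁺))
          := (con 1ℚ :- (q :+ q)) :* τ⁺ :- t :* (con 2ℚ :* e⁺ :- ν⁺)) refl t q e e⁺ τ τ⁺ ν ν⁺))

      tν′ : t * ν ↦′ t * ν⁺
      tν′ = derives (trans (derivative (t′ ⟨*⟩ ν′))
        (solve 3 (λ t ν ν⁺ → con 0ℚ :* ν :+ t :* ν⁺ := t :* ν⁺) refl t ν ν⁺))

    module Varying {t q : Carrier} (t′ : t ↦′ 𝟙 - (q + q)) (q′ : q ↦′ t) where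

      ∫A′ : ∫A t q e τ ν ↦′ A t q e τ ν + ∫A t q e⁺ τ⁺ ν⁺
      ∫A′ = derives (trans (derivative (t′ ⟨*⟩ e′ ⟨+⟩ q′ ⟨*⟩ τ′))
        (solve 6 (λ t q e e⁺ τ τ⁺ →
          ((con 1ℚ :- (q :+ q)) :* e :+ t :* e⁺) :+ (t :* τ :+ q :* τ⁺)
          := ((con 1ℚ :- (q :+ q)) :* e :+ t :* τ) :+ (t :* e⁺ :+ q :* τ⁺)) refl t q e e⁺ τ τ⁺))

      ∫C′ : ∫C t q e τ ν ↦′ C t q e τ ν + ∫C t q e⁺ τ⁺ ν⁺
      ∫C′ = derives (trans (derivative (t′ ⟨*⟩ τ′ ⟨-⟩ q′ ⟨*⟩ (scalar 2ℚ ⟨*⟩ e′ ⟨-⟩ ν′)))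
        (solve 8 (λ t q e e⁺ τ τ⁺ ν ν⁺ →
          ((con 1ℚ :- (q :+ q)) :* τ :+ t :* τ⁺)
            :- (t :* (con 2ℚ :* e :- ν) :+ q :* ((con 0ℚ :* e :+ con 2ℚ :* e⁺) :- ν⁺))
          := ((con 1ℚ :- (q :+ q)) :* τ :- t :* (con 2ℚ :* e :- ν))
            :+ (t :* τ⁺ :- q :* (con 2ℚ :* e⁺ :- ν⁺))) refl t q e e⁺ τ τ⁺ ν ν⁺))

      qν′ : q * ν ↦′ t * ν + q * ν⁺
      qν′ = q′ ⟨*⟩ ν′

open ≡ using (refl; sym; trans; cong; cong₂; subst; subst₂)
open ≡.≡-Reasoning

-- The Pythagorean relation and the trigonometric series in one variable.

module VersineODE (R : ℚAlgebra) where
  open ℚAlgebra R using (_≈_; 0#)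
  open HurwitzCalculus R
  private
    module R = ℚAlgebra R
    module A = ℚAlgebra algebra
  open A using (_+_; _*_; _-_; -_)
  open Constants algebra
  open Solver algebra using (solve; _:=_; _:+_; _:*_; _:-_; :-_; con)
  open Differentiate algebra ∂-derivation
  open Differences R using (difference≈0)
  open Differences algebra using (difference≈0⁻¹)

  -- The defect has derivative zero and initial value zero.
  pythagoras : ∀ {s p} → s ↦′ 𝟙 - (p + p) → p ↦′ s →
    s 0 R.* s 0 ≈ p 0 R.+ p 0 R.- (p 0 R.* p 0 R.+ p 0 R.* p 0) →
    s * s ≋ p + p - (p * p + p * p)
  pythagoras {s} {p} s′ p′ init = difference≈0⁻¹ (linear-ode-unique {I = ⊤}
    (λ _ → s * s - (p + p - (p * p + p * p)))
    (λ _ → difference≈0 init)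
    (λ n _ _ → vanishes-resp ∂F≋0 (λ _ _ → R.refl)) tt)
    where
    ∂F≋0 : ∂ (s * s - (p + p - (p * p + p * p))) ≋ A.0#
    ∂F≋0 = A.trans
      (derivative (s′ ⟨*⟩ s′ ⟨-⟩ (p′ ⟨+⟩ p′ ⟨-⟩ (p′ ⟨*⟩ p′ ⟨+⟩ p′ ⟨*⟩ p′))))
      (A.trans (solve 2 (λ s p →
          let c = con 1ℚ :- (p :+ p) in
          (c :* s :+ s :* c) :- ((s :+ s) :- ((s :* p :+ p :* s) :+ (s :* p :+ p :* s))) := con 0ℚ)
        A.refl s p) A.0-homo)

ℚalgebra : ℚAlgebra
ℚalgebra = record
  { commutativeRing = ℚring
  ; scalars         = -raw-almostCommutative⟶ (fromCommutativeRing ℚring)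
  }

module One = HurwitzCalculus ℚalgebra

Series₁ : ℚAlgebra
Series₁ = One.algebra

module TrigonometricSeries where
  open One using (_≋_; pointwise; at; ∂; ∂-derivation)
  open ℚAlgebra Series₁ using (_+_; _*_; _-_; -_; ⟦_⟧) renaming (trans to ≋-trans; sym to ≋-sym; refl to ≋-refl)
  private module A = ℚAlgebra Series₁
  open Constants Series₁
  open Differentiate Series₁ ∂-derivation
  open Solver Series₁ using (solve; _:=_; _:+_; _:*_; _:-_; :-_; con)
  open HalfAngle Series₁ using (HalfAngle)
  open Differences Series₁ using (difference≈0⁻¹)

  -- sin(√2 x)/√2 and (1 - cos(√2 x))/2
  sine versine : ℕ → ℚ
  sine zero          = 0ℚ
  sine (suc zero)    = 1ℚ
  sine (suc (suc n)) = ℚ.- (sine n ℚ.+ sine n)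
  versine zero    = 0ℚ
  versine (suc n) = sine n

  sine′ : sine ↦′ 𝟙 - (versine + versine)
  sine′ = derives (pointwise λ { zero → refl ; (suc n) → sym (ℚₚ.+-identityˡ _) })

  versine′ : versine ↦′ sine
  versine′ = derives ≋-refl

  fromℕ : ℕ → ℚ
  fromℕ zero    = 0ℚ
  fromℕ (suc n) = 1ℚ ℚ.+ fromℕ n

  fromℕ-+ : ∀ m n → fromℕ (m ℕ.+ n) ≡ fromℕ m ℚ.+ fromℕ n
  fromℕ-+ zero    n = sym (ℚₚ.+-identityˡ _)
  fromℕ-+ (suc m) n = trans (cong (1ℚ ℚ.+_) (fromℕ-+ m n)) (sym (ℚₚ.+-assoc 1ℚ (fromℕ m) (fromℕ n)))

  -- tanPower i is the i-th power of τ = √2 tan(x/√2), read off from τ′ = 1 + τ²/2.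
  tanPower : ℕ → ℕ → ℚ
  tanPower zero    n       = 𝟙 n
  tanPower (suc i) zero    = 0ℚ
  tanPower (suc i) (suc n) = fromℕ (suc i) ℚ.* (tanPower i n ℚ.+ ½ ℚ.* tanPower (suc (suc i)) n)

  tanPower′ : ∀ i → tanPower (suc i) ↦′ ⟦ fromℕ (suc i) ⟧ * (tanPower i + ⟦ ½ ⟧ * tanPower (suc (suc i)))
  tanPower′ i = derives (pointwise λ n → sym (trans
    (at (One.const⊙ (fromℕ (suc i)) (tanPower i + ⟦ ½ ⟧ * tanPower (suc (suc i)))) n)
    (cong (λ x → fromℕ (suc i) ℚ.* (tanPower i n ℚ.+ x)) (at (One.const⊙ ½ (tanPower (suc (suc i)))) n))))

  -- The equation τ′ = 1 + τ²/2 would define τ through the square of the series under construction.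
  -- With all powers as simultaneous unknowns the system is linear and the recursion structural; the
  -- price is this proof that they multiply like powers. Both sides obey the same recursion, because
  -- the factors i + 1 and j + 1 add up in the product rule.
  tanPower-* : ∀ i j → tanPower i * tanPower j ≋ tanPower (i ℕ.+ j)
  tanPower-* i j .at n = go n i j
    where
    T = tanPower
    expand : ∀ n a i j → (⟦ a ⟧ * (T i + ⟦ ½ ⟧ * T (suc (suc i))) * T j) n ≡
                         a ℚ.* ((T i * T j) n ℚ.+ ½ ℚ.* (T (suc (suc i)) * T j) n)
    expand n a i j = trans
      (at (solve 5 (λ a h x y z → a :* (x :+ h :* y) :* z := a :* (x :* z :+ h :* (y :* z)))
            ≋-refl ⟦ a ⟧ ⟦ ½ ⟧ (T i) (T (suc (suc i))) (T j)) n)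
      (trans (at (One.const⊙ a (T i * T j + ⟦ ½ ⟧ * (T (suc (suc i)) * T j))) n)
        (cong (λ x → a ℚ.* ((T i * T j) n ℚ.+ x)) (at (One.const⊙ ½ (T (suc (suc i)) * T j)) n)))

    go : ∀ n i j → (T i * T j) n ≡ T (i ℕ.+ j) n
    go n       zero    j       = at (A.*-identityˡ (T j)) n
    go n       (suc i) zero    = trans (at (A.*-identityʳ (T (suc i))) n) (cong (λ k → T (suc k) n) (sym (ℕₚ.+-identityʳ i)))
    go zero    (suc i) (suc j) = refl
    go (suc n) (suc i) (suc j) = begin
      (∂ (T (suc i)) * T (suc j)) n ℚ.+ (T (suc i) * ∂ (T (suc j))) n
        ≡⟨ cong₂ ℚ._+_ (at (A.*-congʳ {T (suc j)} (derivative (tanPower′ i))) n)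
                       (at (≋-trans (A.*-congˡ {T (suc i)} (derivative (tanPower′ j))) (A.*-comm (T (suc i)) _)) n) ⟩
      (⟦ I ⟧ * (T i + ⟦ ½ ⟧ * T (suc (suc i))) * T (suc j)) n
        ℚ.+ (⟦ J ⟧ * (T j + ⟦ ½ ⟧ * T (suc (suc j))) * T (suc i)) n
        ≡⟨ cong₂ ℚ._+_ (expand n I i (suc j)) (expand n J j (suc i)) ⟩
      I ℚ.* ((T i * T (suc j)) n ℚ.+ ½ ℚ.* (T (suc (suc i)) * T (suc j)) n)
        ℚ.+ J ℚ.* ((T j * T (suc i)) n ℚ.+ ½ ℚ.* (T (suc (suc j)) * T (suc i)) n)
        ≡⟨ cong₂ ℚ._+_ (cong₂ (λ x y → I ℚ.* (x ℚ.+ ½ ℚ.* y)) (go n i (suc j)) (go n (suc (suc i)) (suc j)))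
                       (cong₂ (λ x y → J ℚ.* (x ℚ.+ ½ ℚ.* y))
                         (trans (go n j (suc i)) (cong (λ k → T k n) swap))
                         (trans (go n (suc (suc j)) (suc i)) (cong (λ k → T (suc (suc k)) n) swap))) ⟩
      I ℚ.* X ℚ.+ J ℚ.* X
        ≡⟨ sym (ℚₚ.*-distribʳ-+ X I J) ⟩
      (I ℚ.+ J) ℚ.* X
        ≡⟨ cong (ℚ._* X) (sym (fromℕ-+ (suc i) (suc j))) ⟩
      fromℕ (suc (i ℕ.+ suc j)) ℚ.* X ∎
      where
      I = fromℕ (suc i)
      J = fromℕ (suc j)
      X = T (i ℕ.+ suc j) n ℚ.+ ½ ℚ.* T (suc (suc (i ℕ.+ suc j))) n
      swap : j ℕ.+ suc i ≡ i ℕ.+ suc j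
      swap = trans (ℕₚ.+-comm j (suc i)) (sym (ℕₚ.+-suc i j))

  tangent secant² : ℕ → ℚ
  tangent = tanPower 1
  secant² = ∂ tangent

  tangent′ : tangent ↦′ secant²
  tangent′ = derives ≋-refl

  secant²≋ : secant² ≋ 𝟙 + ⟦ ½ ⟧ * tangent * tangent
  secant²≋ = ≋-trans (derivative (tanPower′ 0)) (≋-trans
    (A.*-congˡ {⟦ fromℕ 1 ⟧} (A.+-congˡ {𝟙} (A.*-congˡ {⟦ ½ ⟧} (≋-sym (tanPower-* 1 1)))))
    (solve 1 (λ t → con 1ℚ :* (con 1ℚ :+ con ½ :* (t :* t)) := con 1ℚ :+ con ½ :* t :* t) ≋-refl tangent))

  secant²′ : secant² ↦′ tangent * secant²
  secant²′ = derives (≋-trans (Derivation.d-cong ∂-derivation secant²≋) (≋-trans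
    (derivative (scalar 1ℚ ⟨+⟩ scalar ½ ⟨*⟩ tangent′ ⟨*⟩ tangent′))
    (solve 2 (λ t v → con 0ℚ :+ ((con 0ℚ :* t :+ con ½ :* v) :* t :+ con ½ :* t :* v) := t :* v)
      ≋-refl tangent secant²)))

  halfAngle : HalfAngle tangent secant² sine versine
  halfAngle = HalfAngleODE.halfAngle-ode ℚalgebra tangent′ secant²′ sine′ versine′
    (record { ν-inverse = refl ; τ-ratio = refl ; Z-double = refl })

  sine-pythagoras : sine * sine ≋ versine + versine - (versine * versine + versine * versine)
  sine-pythagoras = VersineODE.pythagoras ℚalgebra sine′ versine′ refl

  -- cos(x/√2) and √2 sin(x/√2)
  cosine halfSine : ℕ → ℚ
  cosine zero          = 1ℚ
  cosine (suc zero)    = 0ℚ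
  cosine (suc (suc n)) = ℚ.- (½ ℚ.* cosine n)
  halfSine zero    = 0ℚ
  halfSine (suc n) = cosine n

  cosine′ : cosine ↦′ - (⟦ ½ ⟧ * halfSine)
  cosine′ = derives (pointwise λ n → trans (go n) (cong ℚ.-_ (sym (at (One.const⊙ ½ halfSine) n))))
    where
    go : ∀ n → cosine (suc n) ≡ ℚ.- (½ ℚ.* halfSine n)
    go zero    = refl
    go (suc n) = refl

  halfSine′ : halfSine ↦′ cosine
  halfSine′ = derives ≋-refl

  -- The defect F satisfies ∂F = ½ τ F.
  tangent-cosine : tangent * cosine ≋ halfSine
  tangent-cosine = difference≈0⁻¹ (One.linear-ode-unique {I = ⊤}
    (λ _ → F) (λ _ → refl)
    (λ n v _ → One.vanishes-resp ∂F (One.vanishes-⊙ (⟦ ½ ⟧ * tangent) (v tt))) tt)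
    where
    F = tangent * cosine - halfSine
    ∂F : ∂ F ≋ ⟦ ½ ⟧ * tangent * F
    ∂F = ≋-trans (derivative (derives {tangent} secant²≋ ⟨*⟩ cosine′ ⟨-⟩ halfSine′))
      (solve 3 (λ t k h → (con 1ℚ :+ con ½ :* t :* t) :* k :+ t :* (:- (con ½ :* h)) :- k
                          := con ½ :* t :* (t :* k :- h)) ≋-refl tangent cosine halfSine)

  -- Identifies ν, defined as τ′, with the reciprocal of the squared cosine of the theorem. The
  -- derivative of the defect is a multiple of the defect of `tangent-cosine`.
  secant²-cosine² : secant² * (cosine * cosine) ≋ 𝟙
  secant²-cosine² = difference≈0⁻¹ (One.linear-ode-unique {I = ⊤}
    (λ _ → F) (λ _ → refl) (λ n _ _ → One.vanishes-resp ∂F (λ _ _ → refl)) tt)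
    where
    F = secant² * (cosine * cosine) - 𝟙
    ∂F : ∂ F ≋ A.0#
    ∂F = ≋-trans (derivative (secant²′ ⟨*⟩ (cosine′ ⟨*⟩ cosine′) ⟨-⟩ scalar 1ℚ))
      (≋-trans
        (solve 4 (λ t v k h →
            t :* v :* (k :* k) :+ v :* ((:- (con ½ :* h)) :* k :+ k :* (:- (con ½ :* h))) :- con 0ℚ
            := v :* k :* (t :* k :- h)) ≋-refl tangent secant² cosine halfSine)
        (Differences.multiple≈0 Series₁ (secant² * cosine) tangent-cosine))

-- Series in x and z, with y as an index.

module Two = HurwitzCalculus Series₁

Series₂ : ℚAlgebra
Series₂ = Two.algebra

∂x ∂z : Derivation Series₂
∂x = Two.∂-derivation
∂z = Two.coefficientwise One.∂-derivation

-- F a c is the coefficient of xᵃ/a! zᶜ/c!.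
module TwoVariables where
  open TrigonometricSeries
  private
    module S = ℚAlgebra Series₁
    module T = ℚAlgebra Series₂
    module X = Differentiate Series₂ ∂x
    module Z = Differentiate Series₂ ∂z
  open T using (Carrier; _+_; _*_; _-_; -_; ⟦_⟧; _≈_)
  open Constants Series₂
  open AdditionFormulas Series₂ public
  open One using (∂; const; _≋_; pointwise; at; ∂-derivation)

  ofX ofZ : (ℕ → ℚ) → Carrier
  ofX F a = const (F a)
  ofZ F   = Two.const F

  -- The coefficient of yᵇ/b! in F(x + y + z).
  ofSum : (ℕ → ℚ) → ℕ → Carrier
  ofSum F b = Two.taylor ∂-derivation (Two.taylor ∂-derivation F b)

  sx px sz pz : Carrier
  sx = ofX sine
  px = ofX versine
  sz = ofZ sine
  pz = ofZ versine

  e τ ν : ℕ → Carrier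
  e = ofSum (const 1ℚ)
  τ = ofSum tangent
  ν = ofSum secant²

  ofX-z : ∀ F → ofX F Z.↦′ ⟦ 0ℚ ⟧
  ofX-z F = Z.zero↦′ (Two.pointwise λ a → S.refl)

  ofZ-x : ∀ F → ofZ F X.↦′ ⟦ 0ℚ ⟧
  ofZ-x F = X.zero↦′ T.refl

  sx′ : sx X.↦′ 𝟙 - (px + px)
  sx′ = X.derives (Two.pointwise λ
    { zero    → pointwise λ { zero → refl ; (suc c) → refl }
    ; (suc a) → pointwise λ { zero → sym (ℚₚ.+-identityˡ _) ; (suc c) → refl } })

  px′ : px X.↦′ sx
  px′ = X.derives T.refl

  sz′ : sz Z.↦′ 𝟙 - (pz + pz)
  sz′ = Z.derives (Two.pointwise λ
    { zero    → Differentiate.derivative sine′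
    ; (suc a) → pointwise λ _ → refl })

  pz′ : pz Z.↦′ sz
  pz′ = Z.derives (Two.d-const ∂-derivation versine)

  ofSum-x : ∀ F b → ofSum F b X.↦′ ofSum F (suc b)
  ofSum-x F b = X.derives (Two.taylor-cong ∂-derivation (at′ b))
    where
    at′ : ∀ b → ∂ (Two.taylor ∂-derivation F b) ≋ Two.taylor ∂-derivation (∂ F) b
    at′ = Two.at (Two.d-taylor ∂-derivation F)

  ofSum-z : ∀ F b → ofSum F b Z.↦′ ofSum F (suc b)
  ofSum-z F b = Z.derives (T.trans (Two.d-taylor ∂-derivation (Two.taylor ∂-derivation F b))
    (X._↦′_.derivative (ofSum-x F b)))

  e₀≈𝟙 : e 0 ≈ 𝟙
  e₀≈𝟙 = Two.taylor-scalar ∂-derivation 1ℚ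

  sx-pythagoras : sx * sx ≈ px + px - (px * px + px * px)
  sx-pythagoras = VersineODE.pythagoras Series₁ sx′ px′
    (Solver.solve Series₁ 0 (con 0ℚ :* con 0ℚ := con 0ℚ :+ con 0ℚ :- (con 0ℚ :* con 0ℚ :+ con 0ℚ :* con 0ℚ)) S.refl)
    where open Solver Series₁ using (_:=_; _:+_; _:*_; _:-_; con)

  sz-pythagoras : sz * sz ≈ pz + pz - (pz * pz + pz * pz)
  sz-pythagoras = Two.pointwise λ
    { zero    → sine-pythagoras
    ; (suc a) → S.trans (square≈0 sine a) (S.sym (S.trans
        (S.+-congˡ {S.0# S.+ S.0#} (S.-‿cong (S.+-cong (square≈0 versine a) (square≈0 versine a))))
        (pointwise λ _ → refl))) }
    where
    square≈0 : ∀ F a → (ofZ F * ofZ F) (suc a) S.≈ S.0#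
    square≈0 F a = S.trans (Two.at (Two.const⊙ F (ofZ F)) (suc a)) (S.zeroʳ F)

  -- The half-angle relations for the angle x + z. Both sides are treated as functions of x over the
  -- series in z; at x = 0 the sums collapse to `sine` and `versine` of z, where the relations are
  -- known.
  halfAngle₂ : HalfAngle.HalfAngle Series₂ (τ 0) (ν 0) (sinSum sx px sz pz) (versSum sx px sz pz)
  halfAngle₂ = HalfAngleODE.halfAngle-ode Series₁
    (X.derives T.refl)
    (X.derives (T.trans (Two.taylor-cong ∂-derivation (Differentiate.derivative secant²′))
                        (Two.taylor-* ∂-derivation tangent secant²)))
    (X.derives (T.trans (X._↦′_.derivative (sx′ X.⟨*⟩ (X.scalar 1ℚ X.⟨-⟩ (pz₀ X.⟨+⟩ pz₀)) X.⟨+⟩ (X.scalar 1ℚ X.⟨-⟩ (px′ X.⟨+⟩ px′)) X.⟨*⟩ sz₀))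
      (solve 4 (λ s p t q →
        ((con 1ℚ :- (p :+ p)) :* (con 1ℚ :- (q :+ q)) :+ s :* (con 0ℚ :- (con 0ℚ :+ con 0ℚ)))
          :+ ((con 0ℚ :- (s :+ s)) :* t :+ (con 1ℚ :- (p :+ p)) :* con 0ℚ)
        := con 1ℚ :- ((p :+ q :- (p :* q :+ p :* q) :+ s :* t) :+ (p :+ q :- (p :* q :+ p :* q) :+ s :* t)))
        T.refl sx px sz pz)))
    (X.derives (T.trans (X._↦′_.derivative (px′ X.⟨+⟩ pz₀ X.⟨-⟩ (px′ X.⟨*⟩ pz₀ X.⟨+⟩ px′ X.⟨*⟩ pz₀) X.⟨+⟩ sx′ X.⟨*⟩ sz₀))
      (solve 4 (λ s p t q →
        (s :+ con 0ℚ) :- ((s :* q :+ p :* con 0ℚ) :+ (s :* q :+ p :* con 0ℚ))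
          :+ ((con 1ℚ :- (p :+ p)) :* t :+ s :* con 0ℚ)
        := s :* (con 1ℚ :- (q :+ q)) :+ (con 1ℚ :- (p :+ p)) :* t)
        T.refl sx px sz pz)))
    (record
      { ν-inverse = S.trans (S.*-congˡ {secant²} (S.+-congˡ {𝟙₁} (S.-‿cong vers₀))) ν-inverse
      ; τ-ratio   = S.trans (S.*-congˡ {tangent} (S.+-congˡ {𝟙₁} (S.-‿cong vers₀))) (S.trans τ-ratio (S.sym sin₀))
      ; Z-double  = S.trans (S.+-cong vers₀ vers₀) (S.trans Z-double (S.*-congˡ {tangent} (S.sym sin₀)))
      })
    where
    open Solver Series₂ using (solve; _:=_; _:+_; _:*_; _:-_; con)
    module P = Solver Series₁
    open Constants Series₁ using () renaming (𝟙 to 𝟙₁)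
    open HalfAngle.HalfAngle halfAngle
    sz₀ = ofZ-x sine
    pz₀ = ofZ-x versine
    vers₀ : versSum sx px sz pz 0 S.≈ versine
    vers₀ = P.solve 2 (λ t q → P.con 0ℚ P.:+ q P.:- (P.con 0ℚ P.:* q P.:+ P.con 0ℚ P.:* q) P.:+ P.con 0ℚ P.:* t P.:= q)
      S.refl sine versine
    sin₀ : sinSum sx px sz pz 0 S.≈ sine
    sin₀ = P.solve 2 (λ t q → P.con 0ℚ P.:* (P.con 1ℚ P.:- (q P.:+ q)) P.:+ (P.con 1ℚ P.:- (P.con 0ℚ P.:+ P.con 0ℚ)) P.:* t P.:= t)
      S.refl sine versine

-- Antidiagonal sums and the system of conditions on the two triangles.

module Q = Solver ℚalgebra

-- The sum of F i j over i + j + 1 = n.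
antidiagonal : ℕ → (ℕ → ℕ → ℚ) → ℚ
antidiagonal zero    F = 0ℚ
antidiagonal (suc n) F = F n 0 ℚ.+ antidiagonal n (λ i j → F i (suc j))

antidiagonal-cong : ∀ n {F G : ℕ → ℕ → ℚ} → (∀ i j → suc (i ℕ.+ j) ≡ n → F i j ≡ G i j) →
  antidiagonal n F ≡ antidiagonal n G
antidiagonal-cong zero    h = refl
antidiagonal-cong (suc n) h = cong₂ ℚ._+_ (h n 0 (cong suc (ℕₚ.+-identityʳ n)))
  (antidiagonal-cong n (λ i j p → h i (suc j) (cong suc (trans (ℕₚ.+-suc i j) p))))

-- Integration along an antidiagonal: i is the degree in y, j that in x or z, and k is a primitive
-- for the difference of the two derivatives, vanishing at the zero of the second variable. Only k
-- at degree 0 in y survives, which is why identities at y = 0 suffice.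
antidiagonal-telescope : ∀ n {F : ℕ → ℕ → ℚ} (k : ℕ → ℕ → ℚ) → (∀ i j → k i (suc j) ≡ F i j ℚ.+ k (suc i) j) →
  (∀ i → k i 0 ≡ 0ℚ) → antidiagonal n F ≡ k 0 n
antidiagonal-telescope n {F} k step k₀ =
  trans (sym (ℚₚ.+-identityʳ _)) (trans (cong (antidiagonal n F ℚ.+_) (sym (k₀ n))) (go n k step))
  where
  go : ∀ n {F : ℕ → ℕ → ℚ} (k : ℕ → ℕ → ℚ) → (∀ i j → k i (suc j) ≡ F i j ℚ.+ k (suc i) j) →
       antidiagonal n F ℚ.+ k n 0 ≡ k 0 n
  go zero        k step = ℚₚ.+-identityˡ _
  go (suc n) {F} k step = trans
    (Q.solve 3 (λ a b c → (a Q.:+ b) Q.:+ c Q.:= b Q.:+ (a Q.:+ c)) refl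
      (F n 0) (antidiagonal n (λ i j → F i (suc j))) (k (suc n) 0))
    (trans (cong (antidiagonal n (λ i j → F i (suc j)) ℚ.+_) (sym (step n 0))) (go n (λ i j → k i (suc j)) (λ i j → step i (suc j))))

-- With n, m, k recovered from the exponents of x, y, z, u b a c = f n m k above the
-- diagonal (a = 2n - k, b = k - m - 1, c = m - 1) and l b a c = f n m k below it
-- (a = 2n - m, b = m - k - 1, c = k - 1).
module Triangles (u l : ℕ → ℕ → ℕ → ℚ) where

  -- The m-th row and column sums of Mₙ for m = c + 1 and 2n = b + c + 1.
  row column : ℕ → ℕ → ℚ
  row    b c = antidiagonal c (λ i j → l i b j) ℚ.+ antidiagonal b (λ i j → u i j c)
  column b c = antidiagonal c (λ i j → u i b j) ℚ.+ antidiagonal b (λ i j → l i j c)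

  -- Parity does not occur: entries with b + a + c odd belong to no matrix, and once set to 0 they
  -- obey the same equations.
  record DeltaSystem : Set where
    field
      u-zero : ∀ b c → u b 0 c ≡ 0ℚ
      u-one  : ∀ b c → u b 1 c ≡ row b c
      u-rec  : ∀ b a c → u b (2 ℕ.+ a) c ℚ.+ u (2 ℕ.+ b) a c ℚ.+ 2ℚ ℚ.* u b a c ≡ 2ℚ ℚ.* u (suc b) (suc a) c
      l-init : ∀ c → l 0 0 c ≡ One.const 1ℚ c
      l-zero : ∀ b c → l (suc b) 0 c ≡ row b c
      l-one  : ∀ b c → l b 1 c ≡ row b c ℚ.+ column b c
      l-rec  : ∀ b a c → l b (2 ℕ.+ a) c ℚ.+ l (2 ℕ.+ b) a c ℚ.+ 2ℚ ℚ.* l b a c ≡ 2ℚ ℚ.* l (suc b) (suc a) c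

-- The closed form solves the system.

module ClosedForm where
  open TrigonometricSeries
  open TwoVariables
  private
    module S = ℚAlgebra Series₁
    module T = ℚAlgebra Series₂
    module X = Differentiate Series₂ ∂x
    module Z = Differentiate Series₂ ∂z
    module P = Solver Series₁
  open T using (Carrier; _+_; _*_; _-_; -_; ⟦_⟧; _≈_)
  open Constants Series₂
  open One using (at; pointwise; ∂-derivation)

  Aᵇ Cᵇ ∫Aᵇ ∫Cᵇ Rᵇ U L : ℕ → Carrier
  Aᵇ b  = A sz pz (e b) (τ b) (ν b)
  Cᵇ b  = C sz pz (e b) (τ b) (ν b)
  ∫Aᵇ b = ∫A sz pz (e b) (τ b) (ν b)
  ∫Cᵇ b = ∫C sz pz (e b) (τ b) (ν b)
  Rᵇ b  = sz * ν b
  U b   = wave sx px ⟦ 0ℚ ⟧ (Rᵇ b)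
  L b   = wave sx px (Aᵇ b) (Cᵇ b)

  private
    A-x : ∀ b → Aᵇ b X.↦′ Aᵇ (suc b)
    A-x b = Waves.Raise.Fixed.A′ Series₂ ∂x (ofSum-x (One.const 1ℚ) b) (ofSum-x tangent b) (ofSum-x secant² b) (ofZ-x sine) (ofZ-x versine)

    C-x : ∀ b → Cᵇ b X.↦′ Cᵇ (suc b)
    C-x b = Waves.Raise.Fixed.C′ Series₂ ∂x (ofSum-x (One.const 1ℚ) b) (ofSum-x tangent b) (ofSum-x secant² b) (ofZ-x sine) (ofZ-x versine)

    R-x : ∀ b → Rᵇ b X.↦′ Rᵇ (suc b)
    R-x b = Waves.Raise.Fixed.tν′ Series₂ ∂x (ofSum-x (One.const 1ℚ) b) (ofSum-x tangent b) (ofSum-x secant² b) (ofZ-x sine) (ofZ-x versine)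

    ∫A-z : ∀ b → ∫Aᵇ b Z.↦′ Aᵇ b + ∫Aᵇ (suc b)
    ∫A-z b = Waves.Raise.Varying.∫A′ Series₂ ∂z (ofSum-z (One.const 1ℚ) b) (ofSum-z tangent b) (ofSum-z secant² b) sz′ pz′

    ∫C-z : ∀ b → ∫Cᵇ b Z.↦′ Cᵇ b + ∫Cᵇ (suc b)
    ∫C-z b = Waves.Raise.Varying.∫C′ Series₂ ∂z (ofSum-z (One.const 1ℚ) b) (ofSum-z tangent b) (ofSum-z secant² b) sz′ pz′

    qν-z : ∀ b → pz * ν b Z.↦′ Rᵇ b + pz * ν (suc b)
    qν-z b = Waves.Raise.Varying.qν′ Series₂ ∂z (ofSum-z (One.const 1ℚ) b) (ofSum-z tangent b) (ofSum-z secant² b) sz′ pz′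

    coefficient : ∀ {F G : Carrier} → F ≈ G → ∀ a c → F a c ≡ G a c
    coefficient p a = at (Two.at p a)

    0′x : ⟦ 0ℚ ⟧ X.↦′ ⟦ 0ℚ ⟧
    0′x = X.scalar 0ℚ

    0′z : ⟦ 0ℚ ⟧ Z.↦′ ⟦ 0ℚ ⟧ + ⟦ 0ℚ ⟧
    0′z = Z.derives (T.trans (Z._↦′_.derivative (Z.scalar 0ℚ)) (T.+-homo 0ℚ 0ℚ))

    const0 : ∀ c → One.const 0ℚ c ≡ 0ℚ
    const0 zero    = refl
    const0 (suc c) = refl

    0-coefficient : ∀ a c → ⟦ 0ℚ ⟧ a c ≡ 0ℚ
    0-coefficient zero    c = const0 c
    0-coefficient (suc a) c = refl

    𝟚-coefficient : ∀ F a c → (𝟚 * F) a c ≡ 2ℚ ℚ.* F a c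
    𝟚-coefficient F a c = trans (at (Two.at (Two.const⊙ (One.const 2ℚ) F) a) c) (at (One.const⊙ 2ℚ (F a)) c)

    wave-at-0 : ∀ α β → wave sx px α β 0 S.≈ α 0
    wave-at-0 α β = P.solve 2 (λ α β →
      (P.con 1ℚ P.:- (P.con 0ℚ P.:+ P.con 0ℚ)) P.:* α P.:+ P.con 0ℚ P.:* β P.:= α) S.refl (α 0) (β 0)

    wave-at-1 : ∀ {α α⁺ β β⁺} → α X.↦′ α⁺ → β X.↦′ β⁺ → wave sx px α β 1 S.≈ β 0 S.+ α⁺ 0
    wave-at-1 {α} {α⁺} {β} {β⁺} α′ β′ = S.trans (Two.at (Waves.Along.wave-derivative Series₂ ∂x sx′ px′ α′ β′) 0)
      (S.+-cong (wave-at-0 β (- (𝟚 * α))) (wave-at-0 α⁺ β⁺))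

    integral-at-0 : ∀ α β c → integral sx px α β 0 c ≡ 0ℚ
    integral-at-0 α β c = trans (at (P.solve 2 (λ α β → P.con 0ℚ P.:* α P.:+ P.con 0ℚ P.:* β P.:= P.con 0ℚ)
      S.refl (α 0) (β 0)) c) (const0 c)

    wave-rec : ∀ (α β : ℕ → Carrier) → (∀ b → α b X.↦′ α (suc b)) → (∀ b → β b X.↦′ β (suc b)) →
      let w = λ b → wave sx px (α b) (β b) in
      ∀ b a c → w b (2 ℕ.+ a) c ℚ.+ w (2 ℕ.+ b) a c ℚ.+ 2ℚ ℚ.* w b a c ≡ 2ℚ ℚ.* w (suc b) (suc a) c
    wave-rec α β α′ β′ b a c = trans
      (cong (wave sx px (α b) (β b) (2 ℕ.+ a) c ℚ.+ wave sx px (α (2 ℕ.+ b)) (β (2 ℕ.+ b)) a c ℚ.+_)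
        (sym (𝟚-coefficient (wave sx px (α b) (β b)) a c)))
      (trans (coefficient (Waves.Along.wave-equation Series₂ ∂x sx′ px′ (α′ b) (α′ (suc b)) (β′ b) (β′ (suc b))) a c)
        (𝟚-coefficient (λ n → wave sx px (α (suc b)) (β (suc b)) (suc n)) a c))

    -- F involves x and y only through x + y. This links the boundary conditions, taken at x = 0,
    -- with the row and column sums, computed at y = 0.
    transfer : ∀ (F : ℕ → Carrier) → (∀ b → F b X.↦′ F (suc b)) → ∀ b → F b 0 S.≈ F 0 b
    transfer F F′ zero    = S.refl
    transfer F F′ (suc b) = S.trans (transfer (λ b → F (suc b)) (λ b → F′ (suc b)) b)
      (S.sym (Two.at (X._↦′_.derivative (F′ 0)) b))

    VanishesAtZ₀ : Carrier → Set
    VanishesAtZ₀ F = ∀ a → F a 0 ≡ 0ℚ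

    vanishes-* : ∀ F G → VanishesAtZ₀ G → VanishesAtZ₀ (F * G)
    vanishes-* F G v zero    = trans (cong (F 0 0 ℚ.*_) (v 0)) (ℚₚ.*-zeroʳ (F 0 0))
    vanishes-* F G v (suc a) = cong₂ ℚ._+_ (vanishes-* (Two.∂ F) G v a) (vanishes-* F (Two.∂ G) (λ a → v (suc a)) a)

    vanishes-*ˡ : ∀ F G → VanishesAtZ₀ F → VanishesAtZ₀ (F * G)
    vanishes-*ˡ F G v a = trans (coefficient (T.*-comm F G) a 0) (vanishes-* G F v a)

    vanishes-wave : ∀ α β → VanishesAtZ₀ α → VanishesAtZ₀ β → VanishesAtZ₀ (wave sx px α β)
    vanishes-wave α β v w a = cong₂ ℚ._+_ (vanishes-* (𝟙 - (px + px)) α v a) (vanishes-* sx β w a)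

    vanishes-sz : VanishesAtZ₀ sz
    vanishes-sz zero    = refl
    vanishes-sz (suc a) = refl

    vanishes-pz : VanishesAtZ₀ pz
    vanishes-pz zero    = refl
    vanishes-pz (suc a) = refl

    -- Primitives of L and U along z (`rowK`, `columnN`) and of U and L along x (`rowG`, `columnM`).
    rowK rowG columnN columnM : ℕ → Carrier
    rowK b    = wave sx px (∫Aᵇ b) (∫Cᵇ b)
    rowG b    = integral sx px ⟦ 0ℚ ⟧ (Rᵇ b)
    columnN b = wave sx px ⟦ 0ℚ ⟧ (pz * ν b)
    columnM b = integral sx px (Aᵇ b) (Cᵇ b)

  open Triangles U L

  -- The part of a row left of the diagonal lies in L and telescopes in z, the part right of it lies
  -- in U and telescopes in x; `rowIdentity` adds the two end values.
  row-closed : ∀ b c → row b c ≡ Rᵇ 0 b c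
  row-closed b c = trans
    (cong₂ ℚ._+_
      (antidiagonal-telescope c (λ i j → rowK i b j)
        (λ i j → coefficient (Waves.Across.wave-split Series₂ ∂z (ofX-z sine) (ofX-z versine) (∫A-z i) (∫C-z i)) b j)
        (λ i → vanishes-wave (∫Aᵇ i) (∫Cᵇ i)
          (λ a → cong₂ ℚ._+_ (vanishes-*ˡ sz (e i) vanishes-sz a) (vanishes-*ˡ pz (τ i) vanishes-pz a))
          (λ a → cong₂ ℚ._-_ (vanishes-*ˡ sz (τ i) vanishes-sz a) (vanishes-*ˡ pz (𝟚 * e i - ν i) vanishes-pz a)) b))
      (antidiagonal-telescope b (λ i j → rowG i j c)
        (λ i j → coefficient (Waves.Along.integral-derivative Series₂ ∂x sx′ px′ 0′x (R-x i)) j c)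
        (λ i → integral-at-0 ⟦ 0ℚ ⟧ (Rᵇ i) c)))
    (sym (coefficient (rowIdentity e₀≈𝟙 halfAngle₂ sx-pythagoras) b c))

  column-closed : ∀ b c → column b c ≡ Cᵇ 0 b c
  column-closed b c = trans
    (cong₂ ℚ._+_
      (antidiagonal-telescope c (λ i j → columnN i b j)
        (λ i j → coefficient (Waves.Across.wave-split Series₂ ∂z (ofX-z sine) (ofX-z versine) 0′z (qν-z i)) b j)
        (λ i → vanishes-wave ⟦ 0ℚ ⟧ (pz * ν i) (λ a → 0-coefficient a 0) (vanishes-*ˡ pz (ν i) vanishes-pz) b))
      (antidiagonal-telescope b (λ i j → columnM i j c)
        (λ i j → coefficient (Waves.Along.integral-derivative Series₂ ∂x sx′ px′ (A-x i) (C-x i)) j c)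
        (λ i → integral-at-0 (Aᵇ i) (Cᵇ i) c)))
    (sym (coefficient (columnIdentity e₀≈𝟙 halfAngle₂ sz-pythagoras) b c))

  private
    R-transfer : ∀ b c → Rᵇ b 0 c ≡ row b c
    R-transfer b c = trans (at (transfer Rᵇ R-x b) c) (sym (row-closed b c))

    -- ∂y A = R: the constant carried by `e` disappears and the y-derivative of τ is ν.
    A-suc : ∀ b c → Aᵇ (suc b) 0 c ≡ row b c
    A-suc b c = trans (at (S.trans
        (S.+-congʳ {sine S.* ν b 0} (S.trans (S.*-congˡ {(𝟙 - (pz + pz)) 0} (Two.at (Two.taylor-scalar ∂-derivation 1ℚ) (suc b)))
                                          (S.zeroʳ ((𝟙 - (pz + pz)) 0))))
        (S.+-identityˡ (sine S.* ν b 0))) c)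
      (R-transfer b c)

  closedForm-system : DeltaSystem
  closedForm-system = record
    { u-zero = λ b c → trans (at (wave-at-0 ⟦ 0ℚ ⟧ (Rᵇ b)) c) (0-coefficient 0 c)
    ; u-one  = λ b c → trans (at (wave-at-1 0′x (R-x b)) c)
        (trans (cong₂ ℚ._+_ (R-transfer b c) (0-coefficient 0 c)) (ℚₚ.+-identityʳ _))
    ; u-rec  = wave-rec (λ _ → ⟦ 0ℚ ⟧) Rᵇ (λ _ → 0′x) R-x
    ; l-init = λ c → trans (at (wave-at-0 (Aᵇ 0) (Cᵇ 0)) c) (at A₀ c)
    ; l-zero = λ b c → trans (at (wave-at-0 (Aᵇ (suc b)) (Cᵇ (suc b))) c) (A-suc b c)
    ; l-one  = λ b c → trans (at (wave-at-1 (A-x b) (C-x b)) c)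
        (trans (cong₂ ℚ._+_ (trans (at (transfer Cᵇ C-x b) c) (sym (column-closed b c))) (A-suc b c))
               (ℚₚ.+-comm (column b c) (row b c)))
    ; l-rec  = wave-rec Aᵇ Cᵇ A-x C-x
    }
    where
    open HalfAngle.HalfAngle halfAngle using (Z-double)
    -- At x = y = 0 the angle is z alone, where 2p(z) = τ s(z) cancels everything but the constant
    -- 1.
    A₀ : Aᵇ 0 0 S.≈ One.const 1ℚ
    A₀ = S.trans
      (P.solve 3 (λ s p t → (P.con 1ℚ P.:- (p P.:+ p)) P.:* P.con 1ℚ P.:+ s P.:* t
                  P.:= P.con 1ℚ P.:- ((p P.:+ p) P.:- t P.:* s)) S.refl sine versine tangent)
      (S.trans (S.+-congˡ {One.const 1ℚ} (S.-‿cong (Differences.difference≈0 Series₁ Z-double)))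
               (pointwise λ c → ℚₚ.+-identityʳ _))

-- Uniqueness of the solution.

module Uniqueness {u l u′ l′ : ℕ → ℕ → ℕ → ℚ}
  (S : Triangles.DeltaSystem u l) (S′ : Triangles.DeltaSystem u′ l′) where
  private
    module T  = Triangles u l
    module T′ = Triangles u′ l′
    module S  = T.DeltaSystem S
    module S′ = T′.DeltaSystem S′

    AgreeBelow : ℕ → (ℕ → ℕ → ℕ → ℚ) → (ℕ → ℕ → ℕ → ℚ) → Set
    AgreeBelow N v v′ = ∀ b a c → b ℕ.+ a ℕ.+ c < N → v b a c ≡ v′ b a c

    -- All summands have total degree b + c - 1. Rows and columns differ only in which triangle
    -- plays which part.
    sums-agree : ∀ {N v v′ w w′} → AgreeBelow N v v′ → AgreeBelow N w w′ → ∀ b c → b ℕ.+ c ≤ N →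
      antidiagonal c (λ i j → v i b j) ℚ.+ antidiagonal b (λ i j → w i j c)
      ≡ antidiagonal c (λ i j → v′ i b j) ℚ.+ antidiagonal b (λ i j → w′ i j c)
    sums-agree {N} p q b c b+c≤N = cong₂ ℚ._+_
      (antidiagonal-cong c (λ i j e → p i b j (subst (_≤ N) (trans (cong (b ℕ.+_) (sym e)) (eq₁ i b j)) b+c≤N)))
      (antidiagonal-cong b (λ i j e → q i j c (subst (λ x → x ℕ.+ c ≤ N) (sym e) b+c≤N)))
      where
      open +-*-Solver
      eq₁ : ∀ i b j → b ℕ.+ suc (i ℕ.+ j) ≡ suc (i ℕ.+ b ℕ.+ j)
      eq₁ = solve 3 (λ i b j → b :+ (con 1 :+ (i :+ j)) := con 1 :+ (i :+ b :+ j)) refl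

    step : ∀ {x y z w x′ y′ z′ w′} → x ℚ.+ y ℚ.+ 2ℚ ℚ.* z ≡ 2ℚ ℚ.* w → x′ ℚ.+ y′ ℚ.+ 2ℚ ℚ.* z′ ≡ 2ℚ ℚ.* w′ →
      y ≡ y′ → z ≡ z′ → w ≡ w′ → x ≡ x′
    step {x} {y} {z} {w} {x′} p p′ refl refl refl =
      +-cancelʳ y x x′ (+-cancelʳ (2ℚ ℚ.* z) (x ℚ.+ y) (x′ ℚ.+ y) (trans p (sym p′)))

    -- The outer induction, on the total degree, serves the row and column sums. The recurrence
    -- relates entries of the same degree as well, so an inner induction runs on the x-degree a,
    -- which it lowers in every other term.
    agree : ∀ N → AgreeBelow N u u′ × AgreeBelow N l l′
    agree zero    = (λ _ _ _ ()) , (λ _ _ _ ())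
    agree (suc N) = (λ b a c → goᵤ a b c) , (λ b a c → goₗ a b c)
      where
      IHᵤ = proj₁ (agree N)
      IHₗ = proj₂ (agree N)

      rows : ∀ b c → b ℕ.+ c ≤ N → T.row b c ≡ T′.row b c
      rows = sums-agree IHₗ IHᵤ

      columns : ∀ b c → b ℕ.+ c ≤ N → T.column b c ≡ T′.column b c
      columns = sums-agree IHᵤ IHₗ

      open +-*-Solver
      shift₁ : ∀ b a c → b ℕ.+ suc (suc a) ℕ.+ c ≡ suc b ℕ.+ suc a ℕ.+ c
      shift₁ = solve 3 (λ b a c → b :+ (con 2 :+ a) :+ c := con 1 :+ b :+ (con 1 :+ a) :+ c) refl
      shift₂ : ∀ b a c → b ℕ.+ suc (suc a) ℕ.+ c ≡ suc (suc b) ℕ.+ a ℕ.+ c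
      shift₂ = solve 3 (λ b a c → b :+ (con 2 :+ a) :+ c := con 2 :+ b :+ a :+ c) refl

      lower₁ : ∀ b c → b ℕ.+ 1 ℕ.+ c < suc N → b ℕ.+ c ≤ N
      lower₁ b c (s≤s p) = ℕₚ.≤-trans (ℕₚ.+-monoˡ-≤ c (ℕₚ.m≤m+n b 1)) p

      lower₀ : ∀ b c → suc b ℕ.+ 0 ℕ.+ c < suc N → b ℕ.+ c ≤ N
      lower₀ b c (s≤s p) = ℕₚ.≤-trans (ℕₚ.m≤n⇒m≤1+n (ℕₚ.+-monoˡ-≤ c (ℕₚ.m≤m+n b 0))) p

      lower₂ : ∀ b a c → b ℕ.+ suc (suc a) ℕ.+ c < suc N → b ℕ.+ a ℕ.+ c < suc N
      lower₂ b a c p = ℕₚ.≤-<-trans (ℕₚ.+-monoˡ-≤ c (ℕₚ.+-monoʳ-≤ b (ℕₚ.m≤n+m a 2))) p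

      goᵤ : ∀ a b c → b ℕ.+ a ℕ.+ c < suc N → u b a c ≡ u′ b a c
      goᵤ zero          b c p = trans (S.u-zero b c) (sym (S′.u-zero b c))
      goᵤ (suc zero)    b c p = trans (S.u-one b c) (trans (rows b c (lower₁ b c p)) (sym (S′.u-one b c)))
      goᵤ (suc (suc a)) b c p = step (S.u-rec b a c) (S′.u-rec b a c)
        (goᵤ a (suc (suc b)) c (subst (_< suc N) (shift₂ b a c) p))
        (goᵤ a b c (lower₂ b a c p))
        (goᵤ (suc a) (suc b) c (subst (_< suc N) (shift₁ b a c) p))

      goₗ : ∀ a b c → b ℕ.+ a ℕ.+ c < suc N → l b a c ≡ l′ b a c
      goₗ zero          zero    c p = trans (S.l-init c) (sym (S′.l-init c))
      goₗ zero          (suc b) c p = trans (S.l-zero b c) (trans (rows b c (lower₀ b c p)) (sym (S′.l-zero b c)))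
      goₗ (suc zero)    b c p = trans (S.l-one b c) (trans
        (cong₂ ℚ._+_ (rows b c (lower₁ b c p)) (columns b c (lower₁ b c p))) (sym (S′.l-one b c)))
      goₗ (suc (suc a)) b c p = step (S.l-rec b a c) (S′.l-rec b a c)
        (goₗ a (suc (suc b)) c (subst (_< suc N) (shift₂ b a c) p))
        (goₗ a b c (lower₂ b a c p))
        (goₗ (suc a) (suc b) c (subst (_< suc N) (shift₁ b a c) p))

  upper-unique : ∀ b a c → u b a c ≡ u′ b a c
  upper-unique b a c = proj₁ (agree (suc (b ℕ.+ a ℕ.+ c))) b a c ℕₚ.≤-refl

-- From the matrices of the Delta sequence to the system.

ratio : ℕ → ℚ
ratio n = + n ℚ./ 1

-- The quotient is normalised through a gcd that is stuck on a variable n; in constructor form sums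
-- and products compute.
ratio≡mkℚ : ∀ n → ratio n ≡ mkℚ (+ n) 0 (Coprimality.sym (Coprimality.1-coprimeTo n))
ratio≡mkℚ n = ℚₚ.normalize-coprime (Coprimality.sym (Coprimality.1-coprimeTo n))

ratio-+ : ∀ m n → ratio (m ℕ.+ n) ≡ ratio m ℚ.+ ratio n
ratio-+ m n = sym (trans (cong₂ ℚ._+_ (ratio≡mkℚ m) (ratio≡mkℚ n))
  (cong (ℚ._/ 1) (cong₂ ℤ._+_ (ℤₚ.*-identityʳ (+ m)) (ℤₚ.*-identityʳ (+ n)))))

ratio-double : ∀ n → ratio (2 ℕ.* n) ≡ 2ℚ ℚ.* ratio n
ratio-double n = trans (ratio-+ n (n ℕ.+ 0)) (trans (cong (ratio n ℚ.+_) (trans (ratio-+ n 0) (ℚₚ.+-identityʳ (ratio n))))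
  (Q.solve 1 (λ x → x Q.:+ x Q.:= Q.con 2ℚ Q.:* x) refl (ratio n)))

sumℕ-first : ∀ n g → sumℕ (suc n) g ≡ g 0 ℕ.+ sumℕ n (λ i → g (suc i))
sumℕ-first zero    g = sym (ℕₚ.+-identityʳ (g 0))
sumℕ-first (suc n) g = trans (cong (ℕ._+ g (suc n)) (sumℕ-first n g)) (ℕₚ.+-assoc (g 0) _ _)

sumℕ-split : ∀ p q g → sumℕ (p ℕ.+ q) g ≡ sumℕ p g ℕ.+ sumℕ q (λ i → g (p ℕ.+ i))
sumℕ-split zero    q g = refl
sumℕ-split (suc p) q g = trans (sumℕ-first (p ℕ.+ q) g) (trans
  (cong (g 0 ℕ.+_) (sumℕ-split p q (λ i → g (suc i))))
  (trans (sym (ℕₚ.+-assoc (g 0) _ _)) (cong (ℕ._+ sumℕ q (λ i → g (suc p ℕ.+ i))) (sym (sumℕ-first p g)))))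

antidiagonal≡sumʳ : ∀ n {F : ℕ → ℕ → ℚ} (g : ℕ → ℕ) → (∀ i j → suc (i ℕ.+ j) ≡ n → F i j ≡ ratio (g j)) →
  antidiagonal n F ≡ ratio (sumℕ n g)
antidiagonal≡sumʳ zero    g h = refl
antidiagonal≡sumʳ (suc n) g h = trans
  (cong₂ ℚ._+_ (h n 0 (cong suc (ℕₚ.+-identityʳ n)))
    (antidiagonal≡sumʳ n (λ i → g (suc i)) (λ i j p → h i (suc j) (cong suc (trans (ℕₚ.+-suc i j) p)))))
  (trans (sym (ratio-+ (g 0) _)) (cong ratio (sym (sumℕ-first n g))))

antidiagonal≡sumˡ : ∀ n {F : ℕ → ℕ → ℚ} (g : ℕ → ℕ) → (∀ i j → suc (i ℕ.+ j) ≡ n → F i j ≡ ratio (g i)) →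
  antidiagonal n F ≡ ratio (sumℕ n g)
antidiagonal≡sumˡ zero    g h = refl
antidiagonal≡sumˡ (suc n) g h = trans
  (cong₂ ℚ._+_ (h n 0 (cong suc (ℕₚ.+-identityʳ n)))
    (antidiagonal≡sumˡ n g (λ i j p → h i (suc j) (cong suc (trans (ℕₚ.+-suc i j) p)))))
  (trans (ℚₚ.+-comm (ratio (g n)) (ratio (sumℕ n g))) (sym (ratio-+ (sumℕ n g) (g n))))

antidiagonal≡0 : ∀ n {F : ℕ → ℕ → ℚ} → (∀ i j → suc (i ℕ.+ j) ≡ n → F i j ≡ 0ℚ) → antidiagonal n F ≡ 0ℚ
antidiagonal≡0 zero    h = refl
antidiagonal≡0 (suc n) h = cong₂ ℚ._+_ (h n 0 (cong suc (ℕₚ.+-identityʳ n)))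
  (antidiagonal≡0 n (λ i j p → h i (suc j) (cong suc (trans (ℕₚ.+-suc i j) p))))

data Parity (n : ℕ) : Set where
  even : ∀ h → n ≡ h ℕ.+ h → Parity n
  odd  : ∀ h → n ≡ suc (h ℕ.+ h) → Parity n

parity : ∀ n → Parity n
parity zero    = even 0 refl
parity (suc n) with parity n
... | even h p = odd h (cong suc p)
... | odd h p  = even (suc h) (trans (cong suc p) (cong suc (sym (ℕₚ.+-suc h h))))

isEven-double : ∀ h → isEven (h ℕ.+ h) ≡ true
isEven-double zero    = refl
isEven-double (suc h) rewrite ℕₚ.+-suc h h | isEven-double h = refl

module Entries (g : Seq) where
  open +-*-Solver using (solve; _:=_; _:+_; con)

  -- The entries of Mₙ with row index c + 1, column index b + c + 2 and 2n = a + b + c + 2.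
  entry : ℕ → ℕ → ℕ → ℚ
  entry b a c = if isEven (a ℕ.+ b ℕ.+ c)
    then ratio (g ⌊ a ℕ.+ b ℕ.+ c ℕ.+ 2 /2⌋ (suc c) (b ℕ.+ c ℕ.+ 2)) else 0ℚ

  entry-even : ∀ {h} b a c → a ℕ.+ b ℕ.+ c ≡ h ℕ.+ h → entry b a c ≡ ratio (g (suc h) (suc c) (b ℕ.+ c ℕ.+ 2))
  entry-even {h} b a c p = trans
    (cong (λ t → if t then ratio (g ⌊ a ℕ.+ b ℕ.+ c ℕ.+ 2 /2⌋ (suc c) (b ℕ.+ c ℕ.+ 2)) else 0ℚ)
      (trans (cong isEven p) (isEven-double h)))
    (cong (λ n → ratio (g n (suc c) (b ℕ.+ c ℕ.+ 2)))
      (trans (cong ⌊_/2⌋ (trans (cong (ℕ._+ 2) p) (solve 1 (λ h → h :+ h :+ con 2 := (con 1 :+ h) :+ (con 1 :+ h)) refl h)))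
             (sym (ℕₚ.n≡⌊n+n/2⌋ (suc h)))))

  entry-odd : ∀ {h} b a c → a ℕ.+ b ℕ.+ c ≡ suc (h ℕ.+ h) → entry b a c ≡ 0ℚ
  entry-odd {h} b a c p =
    cong (λ t → if t then ratio (g ⌊ a ℕ.+ b ℕ.+ c ℕ.+ 2 /2⌋ (suc c) (b ℕ.+ c ℕ.+ 2)) else 0ℚ)
      (trans (cong isEven p) (cong not (isEven-double h)))

  private
    shift₁ : ∀ a b c → suc a ℕ.+ suc b ℕ.+ c ≡ suc (suc (a ℕ.+ b ℕ.+ c))
    shift₁ = solve 3 (λ a b c → con 1 :+ a :+ (con 1 :+ b) :+ c := con 2 :+ (a :+ b :+ c)) refl
    shift₂ : ∀ a b c → a ℕ.+ suc (suc b) ℕ.+ c ≡ suc (suc (a ℕ.+ b ℕ.+ c))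
    shift₂ = solve 3 (λ a b c → a :+ (con 2 :+ b) :+ c := con 2 :+ (a :+ b :+ c)) refl

  -- The matrix index is shifted by two, which absorbs `2 ≤ n` and the truncated subtractions. For
  -- the transposed sequence this is the recurrence below the diagonal.
  Recurrence : Set
  Recurrence = ∀ n m k → 1 ≤ m → suc m ≤ k → k ≤ suc (suc (n ℕ.+ n)) →
    g (suc (suc n)) m (k ℕ.+ 2) ℕ.+ g (suc (suc n)) m k ℕ.+ 2 ℕ.* g (suc n) m k ≡ 2 ℕ.* g (suc (suc n)) m (k ℕ.+ 1)

  private
    rec-odd : ∀ h b a c → a ℕ.+ b ℕ.+ c ≡ suc (h ℕ.+ h) →
      entry b (2 ℕ.+ a) c ℚ.+ entry (2 ℕ.+ b) a c ℚ.+ 2ℚ ℚ.* entry b a c ≡ 2ℚ ℚ.* entry (suc b) (suc a) c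
    rec-odd h b a c p = trans
      (cong₂ (λ x y → x ℚ.+ 2ℚ ℚ.* y)
        (cong₂ ℚ._+_ (entry-odd {suc h} b (2 ℕ.+ a) c p₂) (entry-odd {suc h} (2 ℕ.+ b) a c (trans (shift₂ a b c) p₂)))
        (entry-odd {h} b a c p))
      (cong (2ℚ ℚ.*_) (sym (entry-odd {suc h} (suc b) (suc a) c (trans (shift₁ a b c) p₂))))
      where
      p₂ : suc (suc (a ℕ.+ b ℕ.+ c)) ≡ suc (suc h ℕ.+ suc h)
      p₂ = trans (cong (λ x → suc (suc x)) p) (cong (λ x → suc (suc x)) (sym (ℕₚ.+-suc h h)))

    rec-even : Recurrence → ∀ h b a c → a ℕ.+ b ℕ.+ c ≡ h ℕ.+ h →
      entry b (2 ℕ.+ a) c ℚ.+ entry (2 ℕ.+ b) a c ℚ.+ 2ℚ ℚ.* entry b a c ≡ 2ℚ ℚ.* entry (suc b) (suc a) c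
    rec-even rec h b a c p = begin
        entry b (2 ℕ.+ a) c ℚ.+ entry (2 ℕ.+ b) a c ℚ.+ 2ℚ ℚ.* entry b a c
          ≡⟨ cong₂ (λ x y → x ℚ.+ 2ℚ ℚ.* y)
              (trans (cong₂ ℚ._+_ (entry-even {suc h} b (2 ℕ.+ a) c p₂)
                         (trans (entry-even {suc h} (2 ℕ.+ b) a c (trans (shift₂ a b c) p₂))
                                (cong (λ k → ratio (g (suc (suc h)) (suc c) k)) (plus₂ (b ℕ.+ c)))))
                     (ℚₚ.+-comm (ratio gk) (ratio gk₂)))
              (entry-even {h} b a c p) ⟩
        ratio gk₂ ℚ.+ ratio gk ℚ.+ 2ℚ ℚ.* ratio gk′
          ≡⟨ cong₂ ℚ._+_ (sym (ratio-+ gk₂ gk)) (sym (ratio-double gk′)) ⟩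
        ratio (gk₂ ℕ.+ gk) ℚ.+ ratio (2 ℕ.* gk′)
          ≡⟨ sym (ratio-+ (gk₂ ℕ.+ gk) (2 ℕ.* gk′)) ⟩
        ratio (gk₂ ℕ.+ gk ℕ.+ 2 ℕ.* gk′)
          ≡⟨ cong ratio (rec h (suc c) k (s≤s z≤n) 
               (subst (suc (suc c) ≤_) (solve 2 (λ b c → con 2 :+ c :+ b := b :+ c :+ con 2) refl b c) (ℕₚ.m≤m+n (suc (suc c)) b))
               (subst₂ _≤_ refl (trans (solve 3 (λ a b c → b :+ c :+ con 2 :+ a := con 2 :+ (a :+ b :+ c)) refl a b c) (cong (λ x → suc (suc x)) p))
                 (ℕₚ.m≤m+n k a))) ⟩
        ratio (2 ℕ.* g (suc (suc h)) (suc c) (k ℕ.+ 1))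
          ≡⟨ ratio-double (g (suc (suc h)) (suc c) (k ℕ.+ 1)) ⟩
        2ℚ ℚ.* ratio (g (suc (suc h)) (suc c) (k ℕ.+ 1))
          ≡⟨ cong (2ℚ ℚ.*_) (sym (trans (entry-even {suc h} (suc b) (suc a) c (trans (shift₁ a b c) p₂))
               (cong (λ k → ratio (g (suc (suc h)) (suc c) k)) (plus₁ (b ℕ.+ c))))) ⟩
        2ℚ ℚ.* entry (suc b) (suc a) c ∎
      where
      k = b ℕ.+ c ℕ.+ 2
      gk = g (suc (suc h)) (suc c) k
      gk₂ = g (suc (suc h)) (suc c) (k ℕ.+ 2)
      gk′ = g (suc h) (suc c) k
      p₂ : suc (suc (a ℕ.+ b ℕ.+ c)) ≡ suc h ℕ.+ suc h
      p₂ = trans (cong (λ x → suc (suc x)) p) (cong suc (sym (ℕₚ.+-suc h h)))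
      plus₁ : ∀ d → suc d ℕ.+ 2 ≡ d ℕ.+ 2 ℕ.+ 1
      plus₁ = solve 1 (λ d → con 1 :+ d :+ con 2 := d :+ con 2 :+ con 1) refl
      plus₂ : ∀ d → suc (suc d) ℕ.+ 2 ≡ d ℕ.+ 2 ℕ.+ 2
      plus₂ = solve 1 (λ d → con 2 :+ d :+ con 2 := d :+ con 2 :+ con 2) refl

  entry-rec : Recurrence → ∀ b a c →
    entry b (2 ℕ.+ a) c ℚ.+ entry (2 ℕ.+ b) a c ℚ.+ 2ℚ ℚ.* entry b a c ≡ 2ℚ ℚ.* entry (suc b) (suc a) c
  entry-rec rec b a c = case parity (a ℕ.+ b ℕ.+ c) of λ
    { (even h p) → rec-even rec h b a c p
    ; (odd h p)  → rec-odd h b a c p }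

infix 8 _ᵀ
-- Transposition exchanges the triangles and the row and column sums, so that each fact is proved
-- for one side only.
_ᵀ : Seq → Seq
(f ᵀ) n m k = f n k m

module RowSums (g : Seq) where
  open Entries
  open +-*-Solver using (solve; _:=_; _:+_; _:*_; con)

  rowEntries : ℕ → ℕ → ℚ
  rowEntries b c = antidiagonal c (λ i j → entry (g ᵀ) i b j) ℚ.+ antidiagonal b (λ i j → entry g i j c)

  private
    left : ∀ {x} i b j c → suc (i ℕ.+ j) ≡ c → b ℕ.+ c ≡ suc x → b ℕ.+ i ℕ.+ j ≡ x
    left i b j c p q = ℕₚ.suc-injective (trans (trans
      (solve 3 (λ i b j → con 1 :+ (b :+ i :+ j) := b :+ (con 1 :+ (i :+ j))) refl i b j) (cong (b ℕ.+_) p)) q)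

    right : ∀ {x} i j b c → suc (i ℕ.+ j) ≡ b → b ℕ.+ c ≡ suc x → j ℕ.+ i ℕ.+ c ≡ x
    right i j b c p q = ℕₚ.suc-injective (trans (trans
      (solve 3 (λ i j c → con 1 :+ (j :+ i :+ c) := con 1 :+ (i :+ j) :+ c) refl i j c) (cong (ℕ._+ c) p)) q)

  -- The matrix has size 2h + 2 = c + 1 + b: row c + 1 consists of c entries left of the diagonal,
  -- the vanishing diagonal entry, and b entries right of it.
  rowEntries-odd : ∀ h b c → (∀ m → g (suc h) m m ≡ 0) → b ℕ.+ c ≡ suc (h ℕ.+ h) →
    rowEntries b c ≡ ratio (rowSum g (suc h) (suc c))
  rowEntries-odd h b c diagonal p = trans
    (cong₂ ℚ._+_
      (antidiagonal≡sumʳ c G (λ i j q → trans (entry-even (g ᵀ) {h} i b j (left i b j c q p))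
        (cong (λ m → ratio (g (suc h) m (suc j)))
          (trans (solve 2 (λ i j → i :+ j :+ con 2 := con 1 :+ (con 1 :+ (i :+ j))) refl i j) (cong suc q)))))
      (antidiagonal≡sumˡ b (λ i → G (c ℕ.+ suc i)) (λ i j q → trans (entry-even g {h} i j c (right i j b c q p))
        (cong (λ k → ratio (g (suc h) (suc c) k))
          (solve 2 (λ i c → i :+ c :+ con 2 := con 1 :+ (c :+ (con 1 :+ i))) refl i c)))))
    (trans (sym (ratio-+ (sumℕ c G) (sumℕ b (λ i → G (c ℕ.+ suc i)))))
      (cong ratio (sym total)))
    where
    G : ℕ → ℕ
    G i = g (suc h) (suc c) (suc i)
    total : rowSum g (suc h) (suc c) ≡ sumℕ c G ℕ.+ sumℕ b (λ i → G (c ℕ.+ suc i))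
    total = trans (cong (λ n → sumℕ n G) (trans
        (solve 1 (λ h → con 2 :* (con 1 :+ h) := con 1 :+ (con 1 :+ (h :+ h))) refl h)
        (trans (cong suc (sym p)) (solve 2 (λ b c → con 1 :+ (b :+ c) := c :+ (con 1 :+ b)) refl b c))))
      (trans (sumℕ-split c (suc b) G) (cong (sumℕ c G ℕ.+_)
        (trans (sumℕ-first b (λ i → G (c ℕ.+ i)))
          (cong (ℕ._+ sumℕ b (λ i → G (c ℕ.+ suc i))) (trans (cong G (ℕₚ.+-identityʳ c)) (diagonal (suc c)))))))

  rowEntries-even : ∀ h b c → b ℕ.+ c ≡ h ℕ.+ h → rowEntries b c ≡ 0ℚ
  rowEntries-even zero zero zero p = refl
  rowEntries-even (suc h) b c p = cong₂ ℚ._+_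
    (antidiagonal≡0 c (λ i j q → entry-odd (g ᵀ) {h} i b j (left i b j c q p′)))
    (antidiagonal≡0 b (λ i j q → entry-odd g {h} i j c (right i j b c q p′)))
    where
    p′ : b ℕ.+ c ≡ suc (suc (h ℕ.+ h))
    p′ = trans p (cong suc (ℕₚ.+-suc h h))

module DeltaSequence (f : Seq) (Δ : IsDelta f) where
  open IsDelta Δ
  open Entries
  open +-*-Solver using (solve; _:=_; _:+_; _:*_; con)
  open RowSums
  open Triangles (entry f) (entry (f ᵀ))

  private
    diagonal : ∀ n m → f (suc n) m m ≡ 0
    diagonal (suc n) m                   = diag (suc (suc n)) (s≤s (s≤s z≤n)) m
    diagonal zero    zero                = outside 1 0 0 (s≤s z≤n) (inj₁ refl)
    diagonal zero    (suc zero)          = init11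
    diagonal zero    (suc (suc zero))    = init22
    diagonal zero    (suc (suc (suc m))) = outside 1 (3 ℕ.+ m) (3 ℕ.+ m) (s≤s z≤n) (inj₂ (inj₂ (inj₁ (s≤s (s≤s (s≤s z≤n))))))

    2≤ : ∀ n → 2 ≤ suc (suc n)
    2≤ n = s≤s (s≤s z≤n)

    double : ∀ n → 2 ℕ.* suc (suc n) ≡ suc (suc (suc (suc (n ℕ.+ n))))
    double = solve 1 (λ n → con 2 :* (con 2 :+ n) := con 4 :+ (n :+ n)) refl

    bound : ∀ n → 2 ℕ.* suc (suc n) ∸ 2 ≡ suc (suc (n ℕ.+ n))
    bound n = cong (_∸ 2) (double n)

    recᵁ : Recurrence f
    recᵁ n m k p q r = recU (suc (suc n)) (2≤ n) m k p q (subst (k ≤_) (sym (bound n)) r)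

    recᴸ : Recurrence (f ᵀ)
    recᴸ n k m p q r = recL (suc (suc n)) (2≤ n) m k p q (subst (m ≤_) (sym (bound n)) r)

    -- For b + c = 2h + 1 the x-degree 1 selects column or row 2N - 1 of the matrix with index N = h
    -- + 2, while x-degree 0 with b raised by one selects row 2N; the sums come from the preceding
    -- matrix, of index h + 1.
    module Boundary (h b c : ℕ) (p : b ℕ.+ c ≡ suc (h ℕ.+ h)) where
      N = suc (suc h)

      c<2N∸1 : suc c ≤ 2 ℕ.* N ∸ 2
      c<2N∸1 = subst (suc c ≤_) (trans (cong suc p) (sym (bound h))) (s≤s (ℕₚ.m≤n+m c b))

      index₁ : b ℕ.+ c ℕ.+ 2 ≡ 2 ℕ.* N ∸ 1
      index₁ = trans (cong (ℕ._+ 2) p) (trans (solve 1 (λ h → con 1 :+ (h :+ h) :+ con 2 := con 3 :+ (h :+ h)) refl h)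
        (sym (cong (_∸ 1) (double h))))

      index₀ : suc b ℕ.+ c ℕ.+ 2 ≡ 2 ℕ.* N
      index₀ = trans (cong (λ x → suc x ℕ.+ 2) p) (solve 1 (λ h → con 2 :+ (h :+ h) :+ con 2 := con 2 :* (con 2 :+ h)) refl h)

      column-2n-1 : f N (suc c) (b ℕ.+ c ℕ.+ 2) ≡ rowSum f (suc h) (suc c)
      column-2n-1 = trans (cong (f N (suc c)) index₁) (col2n-1 N (2≤ h) (suc c) (s≤s z≤n) c<2N∸1)

      row-2n : f N (suc b ℕ.+ c ℕ.+ 2) (suc c) ≡ rowSum f (suc h) (suc c)
      row-2n = trans (cong (λ m → f N m (suc c)) index₀) (row2n N (2≤ h) (suc c) (s≤s z≤n) c<2N∸1)

      row-2n-1 : f N (b ℕ.+ c ℕ.+ 2) (suc c) ≡ rowSum f (suc h) (suc c) ℕ.+ colSum f (suc h) (suc c)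
      row-2n-1 = trans (cong (λ m → f N m (suc c)) index₁) (row2n-1 N (2≤ h) (suc c) (s≤s z≤n) c<2N∸1)

      even-degree : suc (b ℕ.+ c) ≡ suc h ℕ.+ suc h
      even-degree = trans (cong suc p) (cong suc (sym (ℕₚ.+-suc h h)))

    last-column : ∀ h b c → b ℕ.+ c ≡ h ℕ.+ h → f (suc h) (suc c) (b ℕ.+ c ℕ.+ 2) ≡ 0
    last-column zero    zero zero p = init12
    last-column (suc h) b    c    p = trans
      (cong (f (suc (suc h)) (suc c)) (trans (cong (ℕ._+ 2) p)
        (solve 1 (λ h → con 1 :+ h :+ (con 1 :+ h) :+ con 2 := con 2 :* (con 2 :+ h)) refl h)))
      (col2n (suc (suc h)) (2≤ h) (suc c))

    -- The entries (2n, 2n - 1) are the initial data of L; for n ≥ 2 they vanish, which leaves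
    -- `init21` as the only inhomogeneous term of the system.
    corner : ∀ h c → suc c ≡ h ℕ.+ h → f (suc h) (suc c ℕ.+ 2) (suc (suc c)) ≡ 0
    corner (suc h) c p = trans
      (cong₂ (f (suc (suc h)))
        (trans (cong (ℕ._+ 2) p) (solve 1 (λ h → con 1 :+ h :+ (con 1 :+ h) :+ con 2 := con 2 :* (con 2 :+ h)) refl h))
        (trans (cong suc p) (trans (solve 1 (λ h → con 1 :+ (con 1 :+ h :+ (con 1 :+ h)) := con 3 :+ (h :+ h)) refl h) (sym (cong (_∸ 1) (double h))))))
      (row2na (suc (suc h)) (2≤ h))

    u-zero : ∀ b c → entry f b 0 c ≡ 0ℚ
    u-zero b c = case parity (b ℕ.+ c) of λ
      { (even h p) → trans (entry-even f {h} b 0 c p) (cong ratio (last-column h b c p))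
      ; (odd h p)  → entry-odd f {h} b 0 c p }

    u-one : ∀ b c → entry f b 1 c ≡ row b c
    u-one b c = case parity (b ℕ.+ c) of λ
      { (even h p) → trans (entry-odd f {h} b 1 c (cong suc p)) (sym (rowEntries-even f h b c p))
      ; (odd h p)  → let open Boundary h b c p in
          trans (entry-even f {suc h} b 1 c even-degree)
            (trans (cong ratio column-2n-1) (sym (rowEntries-odd f h b c (diagonal h) p))) }

    l-init : ∀ c → entry (f ᵀ) 0 0 c ≡ One.const 1ℚ c
    l-init zero    = cong ratio init21
    l-init (suc c) = case parity (suc c) of λ
      { (even h p) → trans (entry-even (f ᵀ) {h} 0 0 (suc c) p) (cong ratio (corner h c p))
      ; (odd h p)  → entry-odd (f ᵀ) {h} 0 0 (suc c) p }

    l-zero : ∀ b c → entry (f ᵀ) (suc b) 0 c ≡ row b c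
    l-zero b c = case parity (b ℕ.+ c) of λ
      { (even h p) → trans (entry-odd (f ᵀ) {h} (suc b) 0 c (cong suc p)) (sym (rowEntries-even f h b c p))
      ; (odd h p)  → let open Boundary h b c p in
          trans (entry-even (f ᵀ) {suc h} (suc b) 0 c even-degree)
            (trans (cong ratio row-2n) (sym (rowEntries-odd f h b c (diagonal h) p))) }

    l-one : ∀ b c → entry (f ᵀ) b 1 c ≡ row b c ℚ.+ column b c
    l-one b c = case parity (b ℕ.+ c) of λ
      { (even h p) → trans (entry-odd (f ᵀ) {h} b 1 c (cong suc p))
          (sym (cong₂ ℚ._+_ (rowEntries-even f h b c p) (rowEntries-even (f ᵀ) h b c p)))
      ; (odd h p)  → let open Boundary h b c p in
          trans (entry-even (f ᵀ) {suc h} b 1 c even-degree)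
            (trans (cong ratio row-2n-1) (trans (ratio-+ (rowSum f (suc h) (suc c)) (colSum f (suc h) (suc c)))
              (sym (cong₂ ℚ._+_ (rowEntries-odd f h b c (diagonal h) p) (rowEntries-odd (f ᵀ) h b c (diagonal h) p))))) }

  delta-system : DeltaSystem
  delta-system = record
    { u-zero = u-zero
    ; u-one  = u-one
    ; u-rec  = entry-rec f recᵁ
    ; l-init = l-init
    ; l-zero = l-zero
    ; l-one  = l-one
    ; l-rec  = entry-rec (f ᵀ) recᴸ
    }

-- Products of ordinary and of exponential coefficients.

open TrigonometricSeries using (fromℕ; fromℕ-+; sine; cosine)

antidiagonal-+ : ∀ n F G → antidiagonal n (λ i j → F i j ℚ.+ G i j) ≡ antidiagonal n F ℚ.+ antidiagonal n G
antidiagonal-+ zero    F G = refl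
antidiagonal-+ (suc n) F G = trans
  (cong (F n 0 ℚ.+ G n 0 ℚ.+_) (antidiagonal-+ n (λ i j → F i (suc j)) (λ i j → G i (suc j))))
  (Q.solve 4 (λ a b c d → (a Q.:+ b) Q.:+ (c Q.:+ d) Q.:= (a Q.:+ c) Q.:+ (b Q.:+ d)) refl
    (F n 0) (G n 0) (antidiagonal n (λ i j → F i (suc j))) (antidiagonal n (λ i j → G i (suc j))))

antidiagonal-*ʳ : ∀ n F r → antidiagonal n F ℚ.* r ≡ antidiagonal n (λ i j → F i j ℚ.* r)
antidiagonal-*ʳ zero    F r = ℚₚ.*-zeroˡ r
antidiagonal-*ʳ (suc n) F r = trans (ℚₚ.*-distribʳ-+ r (F n 0) (antidiagonal n (λ i j → F i (suc j))))
  (cong (F n 0 ℚ.* r ℚ.+_) (antidiagonal-*ʳ n (λ i j → F i (suc j)) r))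

antidiagonal-last : ∀ n F → antidiagonal (suc n) F ≡ antidiagonal n (λ i j → F (suc i) j) ℚ.+ F 0 n
antidiagonal-last zero    F = ℚₚ.+-comm (F 0 0) 0ℚ
antidiagonal-last (suc n) F = trans
  (cong (F (suc n) 0 ℚ.+_) (antidiagonal-last n (λ i j → F i (suc j))))
  (sym (ℚₚ.+-assoc (F (suc n) 0) (antidiagonal n (λ i j → F (suc i) (suc j))) (F 0 (suc n))))

antidiagonal-swap : ∀ m n (F : ℕ → ℕ → ℕ → ℕ → ℚ) →
  antidiagonal m (λ i j → antidiagonal n (F i j)) ≡ antidiagonal n (λ k l → antidiagonal m (λ i j → F i j k l))
antidiagonal-swap zero    n F = sym (zeros n)
  where
  zeros : ∀ n → antidiagonal n (λ _ _ → 0ℚ) ≡ 0ℚ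
  zeros zero    = refl
  zeros (suc n) = trans (ℚₚ.+-identityˡ (antidiagonal n (λ _ _ → 0ℚ))) (zeros n)
antidiagonal-swap (suc m) n F = trans
  (cong (antidiagonal n (F m 0) ℚ.+_) (antidiagonal-swap m n (λ i j → F i (suc j))))
  (sym (antidiagonal-+ n (F m 0) (λ k l → antidiagonal m (λ i j → F i (suc j) k l))))

sumℚ-cong : ∀ n {g h : ℕ → ℚ} → (∀ i → g i ≡ h i) → sumℚ n g ≡ sumℚ n h
sumℚ-cong zero    p = refl
sumℚ-cong (suc n) p = cong₂ ℚ._+_ (sumℚ-cong n p) (p n)

sumℚ-first : ∀ n g → sumℚ (suc n) g ≡ g 0 ℚ.+ sumℚ n (λ i → g (suc i))
sumℚ-first zero    g = ℚₚ.+-comm 0ℚ (g 0)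
sumℚ-first (suc n) g = trans (cong (ℚ._+ g (suc n)) (sumℚ-first n g)) (ℚₚ.+-assoc (g 0) (sumℚ n (λ i → g (suc i))) (g (suc n)))

sumℚ≡antidiagonal : ∀ n (ψ : ℕ → ℕ → ℚ) → sumℚ (suc n) (λ i → ψ i (n ∸ i)) ≡ antidiagonal (suc n) (λ i j → ψ j i)
sumℚ≡antidiagonal zero    ψ = ℚₚ.+-comm 0ℚ (ψ 0 0)
sumℚ≡antidiagonal (suc n) ψ = trans (sumℚ-first (suc n) (λ i → ψ i (suc n ∸ i)))
  (cong (ψ 0 (suc n) ℚ.+_) (sumℚ≡antidiagonal n (λ i j → ψ (suc i) j)))

ratio-suc : ∀ n → ratio (suc n) ≡ 1ℚ ℚ.+ ratio n
ratio-suc = ratio-+ 1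

fromℕ≡ratio : ∀ n → fromℕ n ≡ ratio n
fromℕ≡ratio zero    = refl
fromℕ≡ratio (suc n) = trans (cong (1ℚ ℚ.+_) (fromℕ≡ratio n)) (sym (ratio-suc n))

ratio-* : ∀ m n → ratio (m ℕ.* n) ≡ ratio m ℚ.* ratio n
ratio-* m n = sym (trans (cong₂ ℚ._*_ (ratio≡mkℚ m) (ratio≡mkℚ n)) (cong (ℚ._/ 1) (sym (ℤₚ.pos-* m n))))

reciprocal : ∀ d {{_ : ℕ.NonZero d}} → ratio d ℚ.* (+ 1 ℚ./ d) ≡ 1ℚ
reciprocal (suc k) = trans
  (cong₂ ℚ._*_ (ratio≡mkℚ (suc k)) (ℚₚ.normalize-coprime (Coprimality.1-coprimeTo (suc k))))
  (ℚₚ.*-inverseʳ (ℚ.mkℚ (+ suc k) 0 (Coprimality.sym (Coprimality.1-coprimeTo (suc k)))))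

fromℕ-suc-cancel : ∀ n {x y} → fromℕ (suc n) ℚ.* x ≡ fromℕ (suc n) ℚ.* y → x ≡ y
fromℕ-suc-cancel n {x} {y} p = trans (expand x) (trans (cong (r ℚ.*_) p) (sym (expand y)))
  where
  r = + 1 ℚ./ suc n
  expand : ∀ x → x ≡ r ℚ.* (fromℕ (suc n) ℚ.* x)
  expand x = sym (trans
    (Q.solve 3 (λ r m x → r Q.:* (m Q.:* x) Q.:= (m Q.:* r) Q.:* x) refl r (fromℕ (suc n)) x)
    (trans (cong (ℚ._* x) (trans (cong (ℚ._* r) (fromℕ≡ratio (suc n))) (reciprocal (suc n)))) (ℚₚ.*-identityˡ x)))

invFact-suc : ∀ n → fromℕ (suc n) ℚ.* invFact (suc n) ≡ invFact n
invFact-suc n = begin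
  fromℕ (suc n) ℚ.* invFact (suc n)
    ≡⟨ cong (ℚ._* invFact (suc n)) (fromℕ≡ratio (suc n)) ⟩
  ratio (suc n) ℚ.* invFact (suc n)
    ≡⟨ sym (ℚₚ.*-identityʳ (ratio (suc n) ℚ.* invFact (suc n))) ⟩
  ratio (suc n) ℚ.* invFact (suc n) ℚ.* 1ℚ
    ≡⟨ cong (ratio (suc n) ℚ.* invFact (suc n) ℚ.*_) (sym (reciprocal (n !) {{n ℕₚ.!≢0}})) ⟩
  ratio (suc n) ℚ.* invFact (suc n) ℚ.* (ratio (n !) ℚ.* invFact n)
    ≡⟨ Q.solve 4 (λ a b c d → a Q.:* b Q.:* (c Q.:* d) Q.:= (a Q.:* c) Q.:* b Q.:* d) refl
         (ratio (suc n)) (invFact (suc n)) (ratio (n !)) (invFact n) ⟩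
  ratio (suc n) ℚ.* ratio (n !) ℚ.* invFact (suc n) ℚ.* invFact n
    ≡⟨ cong (λ x → x ℚ.* invFact (suc n) ℚ.* invFact n) (sym (ratio-* (suc n) (n !))) ⟩
  ratio (suc n !) ℚ.* invFact (suc n) ℚ.* invFact n
    ≡⟨ cong (ℚ._* invFact n) (reciprocal (suc n !) {{suc n ℕₚ.!≢0}}) ⟩
  1ℚ ℚ.* invFact n
    ≡⟨ ℚₚ.*-identityˡ (invFact n) ⟩
  invFact n ∎

-- On every summand n + 1 equals i + j; after distributing, the terms with i = 0 in one sum and j =
-- 0 in the other drop out.
antidiagonal-leibniz : ∀ n ψ → fromℕ (suc n) ℚ.* antidiagonal (suc (suc n)) ψ ≡
  antidiagonal (suc n) (λ i j → fromℕ (suc i) ℚ.* ψ (suc i) j) ℚ.+ antidiagonal (suc n) (λ i j → fromℕ (suc j) ℚ.* ψ i (suc j))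
antidiagonal-leibniz n ψ = begin
  fromℕ (suc n) ℚ.* antidiagonal (suc (suc n)) ψ
    ≡⟨ ℚₚ.*-comm (fromℕ (suc n)) (antidiagonal (suc (suc n)) ψ) ⟩
  antidiagonal (suc (suc n)) ψ ℚ.* fromℕ (suc n)
    ≡⟨ antidiagonal-*ʳ (suc (suc n)) ψ (fromℕ (suc n)) ⟩
  antidiagonal (suc (suc n)) (λ i j → ψ i j ℚ.* fromℕ (suc n))
    ≡⟨ antidiagonal-cong (suc (suc n)) (λ i j p → trans
         (cong (λ m → ψ i j ℚ.* fromℕ m) (sym (ℕₚ.suc-injective p)))
         (trans (cong (ψ i j ℚ.*_) (fromℕ-+ i j))
           (Q.solve 3 (λ x a b → x Q.:* (a Q.:+ b) Q.:= a Q.:* x Q.:+ b Q.:* x) refl (ψ i j) (fromℕ i) (fromℕ j)))) ⟩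
  antidiagonal (suc (suc n)) (λ i j → fromℕ i ℚ.* ψ i j ℚ.+ fromℕ j ℚ.* ψ i j)
    ≡⟨ antidiagonal-+ (suc (suc n)) (λ i j → fromℕ i ℚ.* ψ i j) (λ i j → fromℕ j ℚ.* ψ i j) ⟩
  antidiagonal (suc (suc n)) (λ i j → fromℕ i ℚ.* ψ i j) ℚ.+ antidiagonal (suc (suc n)) (λ i j → fromℕ j ℚ.* ψ i j)
    ≡⟨ cong₂ ℚ._+_
         (trans (antidiagonal-last (suc n) (λ i j → fromℕ i ℚ.* ψ i j))
           (trans (cong (first ℚ.+_) (ℚₚ.*-zeroˡ (ψ 0 (suc n)))) (ℚₚ.+-identityʳ first)))
         (trans (cong (ℚ._+ second) (ℚₚ.*-zeroˡ (ψ (suc n) 0))) (ℚₚ.+-identityˡ second)) ⟩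
  first ℚ.+ second ∎
  where
  first = antidiagonal (suc n) (λ i j → fromℕ (suc i) ℚ.* ψ (suc i) j)
  second = antidiagonal (suc n) (λ i j → fromℕ (suc j) ℚ.* ψ i (suc j))

-- φ stands for extraction of a coefficient in the inner variables. It is additive but not
-- multiplicative, so each use expands the product in one variable and leaves the inner product
-- intact.
module Expansion (R : ℚAlgebra) (φ : ℚAlgebra.Carrier R → ℚ)
  (φ-+ : ∀ x y → φ (ℚAlgebra._+_ R x y) ≡ φ x ℚ.+ φ y) where
  open ℚAlgebra R using (_*_)
  open HurwitzCalculus R using (H; _⊙_; ∂)

  private
    term : H → H → ℕ → ℕ → ℚ
    term F G i j = φ (F j * G i) ℚ.* (invFact j ℚ.* invFact i)

    absorb : ∀ m n x → fromℕ (suc m) ℚ.* (x ℚ.* (invFact (suc m) ℚ.* invFact n)) ≡ x ℚ.* (invFact m ℚ.* invFact n)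
    absorb m n x = trans
      (Q.solve 4 (λ k x a b → k Q.:* (x Q.:* (a Q.:* b)) Q.:= x Q.:* ((k Q.:* a) Q.:* b)) refl
        (fromℕ (suc m)) x (invFact (suc m)) (invFact n))
      (cong (λ y → x ℚ.* (y ℚ.* invFact n)) (invFact-suc m))

    absorb′ : ∀ m n x → fromℕ (suc m) ℚ.* (x ℚ.* (invFact n ℚ.* invFact (suc m))) ≡ x ℚ.* (invFact n ℚ.* invFact m)
    absorb′ m n x = trans
      (Q.solve 4 (λ k x a b → k Q.:* (x Q.:* (b Q.:* a)) Q.:= x Q.:* (b Q.:* (k Q.:* a))) refl
        (fromℕ (suc m)) x (invFact (suc m)) (invFact n))
      (cong (λ y → x ℚ.* (invFact n ℚ.* y)) (invFact-suc m))

  -- Multiplication by n + 1 turns 1/(n+1)! into 1/n!, and the claim becomes the sum of those for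
  -- (∂F, G) and (F, ∂G), matching the recursion of `_⊙_`.
  product-expansion : ∀ n F G → φ ((F ⊙ G) n) ℚ.* invFact n ≡ antidiagonal (suc n) (term F G)
  product-expansion zero    F G = Q.solve 1 (λ x → x Q.:* Q.con 1ℚ Q.:= x Q.:* (Q.con 1ℚ Q.:* Q.con 1ℚ) Q.:+ Q.con 0ℚ) refl (φ (F 0 * G 0))
  product-expansion (suc n) F G = fromℕ-suc-cancel n (begin
    fromℕ (suc n) ℚ.* (φ ((F ⊙ G) (suc n)) ℚ.* invFact (suc n))
      ≡⟨ Q.solve 3 (λ a b c → a Q.:* (b Q.:* c) Q.:= b Q.:* (a Q.:* c)) refl (fromℕ (suc n)) (φ ((F ⊙ G) (suc n))) (invFact (suc n)) ⟩
    φ ((F ⊙ G) (suc n)) ℚ.* (fromℕ (suc n) ℚ.* invFact (suc n))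
      ≡⟨ cong₂ ℚ._*_ (φ-+ ((∂ F ⊙ G) n) ((F ⊙ ∂ G) n)) (invFact-suc n) ⟩
    (φ ((∂ F ⊙ G) n) ℚ.+ φ ((F ⊙ ∂ G) n)) ℚ.* invFact n
      ≡⟨ ℚₚ.*-distribʳ-+ (invFact n) (φ ((∂ F ⊙ G) n)) (φ ((F ⊙ ∂ G) n)) ⟩
    φ ((∂ F ⊙ G) n) ℚ.* invFact n ℚ.+ φ ((F ⊙ ∂ G) n) ℚ.* invFact n
      ≡⟨ cong₂ ℚ._+_ (product-expansion n (∂ F) G) (product-expansion n F (∂ G)) ⟩
    antidiagonal (suc n) (term (∂ F) G) ℚ.+ antidiagonal (suc n) (term F (∂ G))
      ≡⟨ ℚₚ.+-comm (antidiagonal (suc n) (term (∂ F) G)) (antidiagonal (suc n) (term F (∂ G))) ⟩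
    antidiagonal (suc n) (term F (∂ G)) ℚ.+ antidiagonal (suc n) (term (∂ F) G)
      ≡⟨ cong₂ ℚ._+_
           (antidiagonal-cong (suc n) (λ i j _ → sym (absorb′ i j (φ (F j * G (suc i))))))
           (antidiagonal-cong (suc n) (λ i j _ → sym (absorb j i (φ (F (suc j) * G i))))) ⟩
    antidiagonal (suc n) (λ i j → fromℕ (suc i) ℚ.* term F G (suc i) j) ℚ.+ antidiagonal (suc n) (λ i j → fromℕ (suc j) ℚ.* term F G i (suc j))
      ≡⟨ sym (antidiagonal-leibniz n (term F G)) ⟩
    fromℕ (suc n) ℚ.* antidiagonal (suc (suc n)) (term F G) ∎)

module Three = HurwitzCalculus Series₂

Series₃ : ℚAlgebra
Series₃ = Three.algebra

-- The ordinary coefficients of Σ F b a c xᵃ/a! yᵇ/b! zᶜ/c!.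
exponential : (ℕ → ℕ → ℕ → ℚ) → PS3
exponential F a b c = F b a c ℚ.* invFact a ℚ.* invFact b ℚ.* invFact c

⊛-cong : ∀ {F F′ G G′ : PS3} → (∀ a b c → F a b c ≡ F′ a b c) → (∀ a b c → G a b c ≡ G′ a b c) →
  ∀ a b c → (F ⊛ G) a b c ≡ (F′ ⊛ G′) a b c
⊛-cong p q a b c = sumℚ-cong (suc a) λ i → sumℚ-cong (suc b) λ j → sumℚ-cong (suc c) λ l →
  cong₂ ℚ._*_ (p i j l) (q (a ∸ i) (b ∸ j) (c ∸ l))

⊛-exponential : ∀ F G a b c → (exponential F ⊛ exponential G) a b c ≡ exponential (F Three.⊙ G) a b c
⊛-exponential F G a b c = trans ⊛≡antidiagonals (sym ⊙≡antidiagonals)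
  where
  summand : ℕ → ℕ → ℕ → ℕ → ℕ → ℕ → ℚ
  summand i′ i j′ j l′ l = exponential F i j l ℚ.* exponential G i′ j′ l′

  ⊛≡antidiagonals : (exponential F ⊛ exponential G) a b c ≡
    antidiagonal (suc b) (λ j′ j → antidiagonal (suc a) (λ i′ i → antidiagonal (suc c) (summand i′ i j′ j)))
  ⊛≡antidiagonals = begin
    (exponential F ⊛ exponential G) a b c
      ≡⟨ (sumℚ-cong (suc a) λ i → sumℚ-cong (suc b) λ j →
            sumℚ≡antidiagonal c (λ l l′ → summand (a ∸ i) i (b ∸ j) j l′ l)) ⟩
    sumℚ (suc a) (λ i → sumℚ (suc b) λ j → antidiagonal (suc c) (summand (a ∸ i) i (b ∸ j) j))
      ≡⟨ (sumℚ-cong (suc a) λ i →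
            sumℚ≡antidiagonal b (λ j j′ → antidiagonal (suc c) (summand (a ∸ i) i j′ j))) ⟩
    sumℚ (suc a) (λ i → antidiagonal (suc b) λ j′ j → antidiagonal (suc c) (summand (a ∸ i) i j′ j))
      ≡⟨ sumℚ≡antidiagonal a (λ i i′ → antidiagonal (suc b) λ j′ j → antidiagonal (suc c) (summand i′ i j′ j)) ⟩
    antidiagonal (suc a) (λ i′ i → antidiagonal (suc b) λ j′ j → antidiagonal (suc c) (summand i′ i j′ j))
      -- The Cauchy product sums over the exponent of x outermost, the iterated series have y
      -- outermost.
      ≡⟨ antidiagonal-swap (suc a) (suc b) (λ i′ i j′ j → antidiagonal (suc c) (summand i′ i j′ j)) ⟩
    _ ∎

  module Ex₃ = Expansion Series₂ (λ P → P a c) (λ _ _ → refl)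
  module Ex₂ = Expansion Series₁ (λ P → P c) (λ _ _ → refl)
  module Ex₁ = Expansion ℚalgebra (λ p → p) (λ _ _ → refl)

  regroup : ∀ x p q r → x ℚ.* p ℚ.* q ℚ.* r ≡ (x ℚ.* q) ℚ.* (p ℚ.* r)
  regroup = Q.solve 4 (λ x p q r → x Q.:* p Q.:* q Q.:* r Q.:= (x Q.:* q) Q.:* (p Q.:* r)) refl

  level₁ : ∀ i′ i j′ j → (F j i One.⊙ G j′ i′) c ℚ.* (invFact i ℚ.* invFact i′) ℚ.* ((invFact j ℚ.* invFact j′) ℚ.* invFact c)
    ≡ antidiagonal (suc c) (summand i′ i j′ j)
  level₁ i′ i j′ j = begin
    (F j i One.⊙ G j′ i′) c ℚ.* (invFact i ℚ.* invFact i′) ℚ.* ((invFact j ℚ.* invFact j′) ℚ.* invFact c)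
      ≡⟨ Q.solve 4 (λ x p q r → x Q.:* p Q.:* (q Q.:* r) Q.:= (x Q.:* r) Q.:* (p Q.:* q)) refl
           ((F j i One.⊙ G j′ i′) c) (invFact i ℚ.* invFact i′) (invFact j ℚ.* invFact j′) (invFact c) ⟩
    (F j i One.⊙ G j′ i′) c ℚ.* invFact c ℚ.* k
      ≡⟨ cong (ℚ._* k) (Ex₁.product-expansion c (F j i) (G j′ i′)) ⟩
    antidiagonal (suc c) (λ l′ l → F j i l ℚ.* G j′ i′ l′ ℚ.* (invFact l ℚ.* invFact l′)) ℚ.* k
      ≡⟨ antidiagonal-*ʳ (suc c) (λ l′ l → F j i l ℚ.* G j′ i′ l′ ℚ.* (invFact l ℚ.* invFact l′)) k ⟩
    antidiagonal (suc c) (λ l′ l → F j i l ℚ.* G j′ i′ l′ ℚ.* (invFact l ℚ.* invFact l′) ℚ.* k)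
      ≡⟨ antidiagonal-cong (suc c) (λ l′ l _ →
           Q.solve 8 (λ x y l l′ i i′ j j′ → x Q.:* y Q.:* (l Q.:* l′) Q.:* ((i Q.:* i′) Q.:* (j Q.:* j′))
              Q.:= (x Q.:* i Q.:* j Q.:* l) Q.:* (y Q.:* i′ Q.:* j′ Q.:* l′)) refl
             (F j i l) (G j′ i′ l′) (invFact l) (invFact l′) (invFact i) (invFact i′) (invFact j) (invFact j′)) ⟩
    antidiagonal (suc c) (summand i′ i j′ j) ∎
    where
    k = (invFact i ℚ.* invFact i′) ℚ.* (invFact j ℚ.* invFact j′)

  level₂ : ∀ j′ j → (F j Two.⊙ G j′) a c ℚ.* (invFact j ℚ.* invFact j′) ℚ.* (invFact a ℚ.* invFact c)
    ≡ antidiagonal (suc a) (λ i′ i → antidiagonal (suc c) (summand i′ i j′ j))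
  level₂ j′ j = begin
    (F j Two.⊙ G j′) a c ℚ.* (invFact j ℚ.* invFact j′) ℚ.* (invFact a ℚ.* invFact c)
      ≡⟨ Q.solve 4 (λ x p q r → x Q.:* p Q.:* (q Q.:* r) Q.:= (x Q.:* q) Q.:* (p Q.:* r)) refl
           ((F j Two.⊙ G j′) a c) (invFact j ℚ.* invFact j′) (invFact a) (invFact c) ⟩
    (F j Two.⊙ G j′) a c ℚ.* invFact a ℚ.* k
      ≡⟨ cong (ℚ._* k) (Ex₂.product-expansion a (F j) (G j′)) ⟩
    antidiagonal (suc a) (λ i′ i → (F j i One.⊙ G j′ i′) c ℚ.* (invFact i ℚ.* invFact i′)) ℚ.* k
      ≡⟨ antidiagonal-*ʳ (suc a) (λ i′ i → (F j i One.⊙ G j′ i′) c ℚ.* (invFact i ℚ.* invFact i′)) k ⟩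
    antidiagonal (suc a) (λ i′ i → (F j i One.⊙ G j′ i′) c ℚ.* (invFact i ℚ.* invFact i′) ℚ.* k)
      ≡⟨ antidiagonal-cong (suc a) (λ i′ i _ → level₁ i′ i j′ j) ⟩
    antidiagonal (suc a) (λ i′ i → antidiagonal (suc c) (summand i′ i j′ j)) ∎
    where
    k = (invFact j ℚ.* invFact j′) ℚ.* invFact c

  ⊙≡antidiagonals : exponential (F Three.⊙ G) a b c ≡
    antidiagonal (suc b) (λ j′ j → antidiagonal (suc a) (λ i′ i → antidiagonal (suc c) (summand i′ i j′ j)))
  ⊙≡antidiagonals = begin
    exponential (F Three.⊙ G) a b c
      ≡⟨ regroup ((F Three.⊙ G) b a c) (invFact a) (invFact b) (invFact c) ⟩
    (F Three.⊙ G) b a c ℚ.* invFact b ℚ.* k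
      ≡⟨ cong (ℚ._* k) (Ex₃.product-expansion b F G) ⟩
    antidiagonal (suc b) (λ j′ j → (F j Two.⊙ G j′) a c ℚ.* (invFact j ℚ.* invFact j′)) ℚ.* k
      ≡⟨ antidiagonal-*ʳ (suc b) (λ j′ j → (F j Two.⊙ G j′) a c ℚ.* (invFact j ℚ.* invFact j′)) k ⟩
    antidiagonal (suc b) (λ j′ j → (F j Two.⊙ G j′) a c ℚ.* (invFact j ℚ.* invFact j′) ℚ.* k)
      ≡⟨ antidiagonal-cong (suc b) (λ j′ j _ → level₂ j′ j) ⟩
    antidiagonal (suc b) (λ j′ j → antidiagonal (suc a) (λ i′ i → antidiagonal (suc c) (summand i′ i j′ j))) ∎
    where
    k = invFact a ℚ.* invFact c

-- Functions of x + y + z as series in three variables.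

module ThreeVariables where
  open TrigonometricSeries
  open TwoVariables
  open ClosedForm using (U)
  private
    module S = ℚAlgebra Series₁
    module T = ℚAlgebra Series₂
    module V = ℚAlgebra Series₃

  -- Expanding in y is a Taylor expansion along ∂x, which exhibits `ofSum` as a composite of two
  -- Taylor homomorphisms and hence as multiplicative.
  ofSum≈taylor : ∀ F → ofSum F V.≈ Three.taylor ∂x (Two.taylor One.∂-derivation F)
  ofSum≈taylor F = Three.pointwise (λ b → go b F)
    where
    go : ∀ b F → ofSum F b T.≈ Three.taylor ∂x (Two.taylor One.∂-derivation F) b
    go zero    F = T.refl
    go (suc b) F = go b (One.∂ F)

  ofSum-* : ∀ F G → ofSum (F S.* G) V.≈ ofSum F V.* ofSum G
  ofSum-* F G = V.trans (ofSum≈taylor (F S.* G)) (V.trans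
    (Three.taylor-cong ∂x (Two.taylor-* One.∂-derivation F G)) (V.trans
    (Three.taylor-* ∂x (Two.taylor One.∂-derivation F) (Two.taylor One.∂-derivation G))
    (V.*-cong (V.sym (ofSum≈taylor F)) (V.sym (ofSum≈taylor G)))))

  ofSum-cong : ∀ {F G} → F S.≈ G → ofSum F V.≈ ofSum G
  ofSum-cong {F} {G} p = V.trans (ofSum≈taylor F) (V.trans
    (Three.taylor-cong ∂x (Two.taylor-cong One.∂-derivation p)) (V.sym (ofSum≈taylor G)))

  ofSum-𝟙 : ofSum (One.const 1ℚ) V.≈ V.1#
  ofSum-𝟙 = V.trans (ofSum≈taylor (One.const 1ℚ)) (V.trans
    (Three.taylor-cong ∂x (Two.taylor-scalar One.∂-derivation 1ℚ)) (Three.taylor-scalar ∂x 1ℚ))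

  ofSum-coefficient : ∀ F b a c → ofSum F b a c ≡ F (a ℕ.+ b ℕ.+ c)
  ofSum-coefficient F b a c = trans (go a (Two.taylor One.∂-derivation F b) c)
    (trans (go b F (a ℕ.+ c)) (cong F (trans (sym (ℕₚ.+-assoc b a c)) (cong (ℕ._+ c) (ℕₚ.+-comm b a)))))
    where
    go : ∀ b F c → Two.taylor One.∂-derivation F b c ≡ F (b ℕ.+ c)
    go zero    F c = refl
    go (suc b) F c = go b (One.∂ F) c

  cos² : ℕ → T.Carrier
  cos² = ofSum cosine V.* ofSum cosine

  U-cos² : U V.* cos² V.≈ Three.const (sx T.* sz)
  U-cos² = V.trans (V.*-congʳ {cos²} U≈) (V.trans
    (V.*-assoc (Three.const (sx T.* sz)) (ofSum secant²) cos²) (V.trans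
    (V.*-congˡ {Three.const (sx T.* sz)} unit)
    (V.*-identityʳ (Three.const (sx T.* sz)))))
    where
    open Solver Series₂ using (solve; _:=_; _:+_; _:*_; _:-_; con)
    U≈ : U V.≈ Three.const (sx T.* sz) V.* ofSum secant²
    U≈ = V.trans
      (Three.pointwise λ b → solve 4 (λ s p t v → (con 1ℚ :- (p :+ p)) :* con 0ℚ :+ s :* (t :* v) := s :* t :* v)
        T.refl sx px sz (ν b))
      (V.sym (Three.const⊙ (sx T.* sz) (ofSum secant²)))
    unit : ofSum secant² V.* cos² V.≈ V.1#
    unit = V.trans (V.*-congˡ {ofSum secant²} (V.sym (ofSum-* cosine cosine))) (V.trans
      (V.sym (ofSum-* secant² (cosine S.* cosine))) (V.trans (ofSum-cong secant²-cosine²) ofSum-𝟙))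

  sxsz-coefficient : ∀ a c → (sx T.* sz) a c ≡ sine a ℚ.* sine c
  sxsz-coefficient a c = trans (One.at (Two.at (T.trans (T.*-comm sx sz) (Two.const⊙ sine sx)) a) c)
    (One.at (S.trans (S.*-comm sine (One.const (sine a))) (One.const⊙ (sine a) sine)) c)

-- Identification with the series of the theorem.

open TwoVariables using (ofSum; sx; sz)
open ThreeVariables

cosine-closed : ∀ n → cosine n ≡ (if isEven n then sgn ⌊ n /2⌋ ℚ.* invPow2 ⌊ n /2⌋ else 0ℚ)
cosine-closed zero          = refl
cosine-closed (suc zero)    = refl
cosine-closed (suc (suc n)) = trans (cong (λ x → ℚ.- (ℚ.½ ℚ.* x)) (cosine-closed n))
  (step (isEven n) (isEven ⌊ n /2⌋) (invPow2 ⌊ n /2⌋))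
  where
  step : ∀ e o p → ℚ.- (ℚ.½ ℚ.* (if e then (if o then 1ℚ else ℚ.- 1ℚ) ℚ.* p else 0ℚ)) ≡
    (if not (not e) then (if not o then 1ℚ else ℚ.- 1ℚ) ℚ.* (ℚ.½ ℚ.* p) else 0ℚ)
  step false o     p = refl
  step true  true  p = Q.solve 1 (λ x → Q.:- (Q.con ℚ.½ Q.:* (Q.con 1ℚ Q.:* x)) Q.:= Q.con (ℚ.- 1ℚ) Q.:* (Q.con ℚ.½ Q.:* x)) refl p
  step true  false p = Q.solve 1 (λ x → Q.:- (Q.con ℚ.½ Q.:* (Q.con (ℚ.- 1ℚ) Q.:* x)) Q.:= Q.con 1ℚ Q.:* (Q.con ℚ.½ Q.:* x)) refl p

pow2-suc : ∀ n → pow2 (suc n) ≡ 2ℚ ℚ.* pow2 n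
pow2-suc n = ratio-double (2 ℕ.^ n)

sine-closed : ∀ n → sine n ≡ (if isEven n then 0ℚ else sgn ⌊ n /2⌋ ℚ.* pow2 ⌊ n /2⌋)
sine-closed zero          = refl
sine-closed (suc zero)    = refl
sine-closed (suc (suc n)) = trans (cong (λ x → ℚ.- (x ℚ.+ x)) (sine-closed n))
  (trans (step (isEven n) (isEven ⌊ n /2⌋) (pow2 ⌊ n /2⌋))
    (cong (λ x → if isEven (suc (suc n)) then 0ℚ else sgn (suc ⌊ n /2⌋) ℚ.* x) (sym (pow2-suc ⌊ n /2⌋))))
  where
  step : ∀ e o p → let x = if e then 0ℚ else (if o then 1ℚ else ℚ.- 1ℚ) ℚ.* p in
    ℚ.- (x ℚ.+ x) ≡ (if not (not e) then 0ℚ else (if not o then 1ℚ else ℚ.- 1ℚ) ℚ.* (2ℚ ℚ.* p))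
  step true  o     p = refl
  step false true  p = Q.solve 1 (λ x → Q.:- (Q.con 1ℚ Q.:* x Q.:+ Q.con 1ℚ Q.:* x) Q.:= Q.con (ℚ.- 1ℚ) Q.:* (Q.con 2ℚ Q.:* x)) refl p
  step false false p = Q.solve 1 (λ x → Q.:- (Q.con (ℚ.- 1ℚ) Q.:* x Q.:+ Q.con (ℚ.- 1ℚ) Q.:* x) Q.:= Q.con 1ℚ Q.:* (Q.con 2ℚ Q.:* x)) refl p

sinS2overS2≡ : ∀ a → sinS2overS2 a ≡ sine a ℚ.* invFact a
sinS2overS2≡ a = trans (distribute (isEven a) (sgn ⌊ a /2⌋ ℚ.* pow2 ⌊ a /2⌋) (invFact a))
  (cong (ℚ._* invFact a) (sym (sine-closed a)))
  where
  distribute : ∀ e x y → (if e then 0ℚ else x ℚ.* y) ≡ (if e then 0ℚ else x) ℚ.* y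
  distribute true  x y = sym (ℚₚ.*-zeroˡ y)
  distribute false x y = refl

if-*³ : ∀ e w x y z → (if e then w ℚ.* x ℚ.* y ℚ.* z else 0ℚ) ≡ (if e then w else 0ℚ) ℚ.* x ℚ.* y ℚ.* z
if-*³ true  w x y z = refl
if-*³ false w x y z = Q.solve 3 (λ x y z → Q.con 0ℚ Q.:= Q.con 0ℚ Q.:* x Q.:* y Q.:* z) refl x y z

cosSeries≡ : ∀ a b c → cosSeries a b c ≡ exponential (ofSum cosine) a b c
cosSeries≡ a b c = trans
  (if-*³ (isEven (a ℕ.+ b ℕ.+ c)) (sgn ⌊ a ℕ.+ b ℕ.+ c /2⌋ ℚ.* invPow2 ⌊ a ℕ.+ b ℕ.+ c /2⌋) (invFact a) (invFact b) (invFact c))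
  (cong (λ w → w ℚ.* invFact a ℚ.* invFact b ℚ.* invFact c)
    (sym (trans (ofSum-coefficient cosine b a c) (cosine-closed (a ℕ.+ b ℕ.+ c)))))

denSeries≡ : ∀ a b c → denSeries a b c ≡ exponential (ℚAlgebra._*_ Series₃ (Constants.𝟚 Series₃) cos²) a b c
denSeries≡ a b c = begin
  2ℚ ℚ.* (cosSeries ⊛ cosSeries) a b c
    ≡⟨ cong (2ℚ ℚ.*_) (trans (⊛-cong cosSeries≡ cosSeries≡ a b c) (⊛-exponential (ofSum cosine) (ofSum cosine) a b c)) ⟩
  2ℚ ℚ.* exponential cos² a b c
    ≡⟨ Q.solve 4 (λ w x y z → Q.con 2ℚ Q.:* (w Q.:* x Q.:* y Q.:* z) Q.:= (Q.con 2ℚ Q.:* w) Q.:* x Q.:* y Q.:* z) refl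
         (cos² b a c) (invFact a) (invFact b) (invFact c) ⟩
  2ℚ ℚ.* cos² b a c ℚ.* invFact a ℚ.* invFact b ℚ.* invFact c
    ≡⟨ cong (λ w → w ℚ.* invFact a ℚ.* invFact b ℚ.* invFact c) (sym (𝟚-coefficient cos²)) ⟩
  exponential (ℚAlgebra._*_ Series₃ (Constants.𝟚 Series₃) cos²) a b c ∎
  where
  𝟚-coefficient : ∀ F → (Three.const (Two.const (One.const 2ℚ)) Three.⊙ F) b a c ≡ 2ℚ ℚ.* F b a c
  𝟚-coefficient F = trans (One.at (Two.at (Three.at (Three.const⊙ (Two.const (One.const 2ℚ)) F) b) a) c)
    (trans (One.at (Two.at (Two.const⊙ (One.const 2ℚ) (F b)) a) c) (One.at (One.const⊙ 2ℚ (F b a)) c))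

lhsSeries≡ : ∀ f → IsDelta f → ∀ a b c → lhsSeries f a b c ≡ exponential ClosedForm.U a b c
lhsSeries≡ f Δ a b c = trans (go a)
  (cong (λ w → w ℚ.* invFact a ℚ.* invFact b ℚ.* invFact c)
    (Uniqueness.upper-unique (DeltaSequence.delta-system f Δ) ClosedForm.closedForm-system b a c))
  where
  open Entries f
  go : ∀ a → lhsSeries f a b c ≡ entry b a c ℚ.* invFact a ℚ.* invFact b ℚ.* invFact c
  -- The range condition excludes a = 0, that is k = 2n, whereas `entry` reads column 2n there; that
  -- column is zero.
  go zero    = trans (if-*³ false 0ℚ (invFact 0) (invFact b) (invFact c))
    (cong (λ w → w ℚ.* invFact 0 ℚ.* invFact b ℚ.* invFact c)
      (sym (Triangles.DeltaSystem.u-zero (DeltaSequence.delta-system f Δ) b c)))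
  go (suc a) = if-*³ (isEven (suc a ℕ.+ b ℕ.+ c)) (ratio (f ⌊ suc a ℕ.+ b ℕ.+ c ℕ.+ 2 /2⌋ (suc c) (b ℕ.+ c ℕ.+ 2)))
    (invFact (suc a)) (invFact b) (invFact c)

numSeries≡ : ∀ a b c → exponential (λ b a c → 2ℚ ℚ.* Three.const (ℚAlgebra._*_ Series₂ sx sz) b a c) a b c ≡ numSeries a b c
numSeries≡ a zero    c = begin
  2ℚ ℚ.* (ℚAlgebra._*_ Series₂ sx sz) a c ℚ.* invFact a ℚ.* 1ℚ ℚ.* invFact c
    ≡⟨ cong (λ w → 2ℚ ℚ.* w ℚ.* invFact a ℚ.* 1ℚ ℚ.* invFact c) (sxsz-coefficient a c) ⟩
  2ℚ ℚ.* (sine a ℚ.* sine c) ℚ.* invFact a ℚ.* 1ℚ ℚ.* invFact c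
    ≡⟨ Q.solve 4 (λ s t x z → Q.con 2ℚ Q.:* (s Q.:* t) Q.:* x Q.:* Q.con 1ℚ Q.:* z Q.:= Q.con 2ℚ Q.:* (s Q.:* x) Q.:* (t Q.:* z)) refl
         (sine a) (sine c) (invFact a) (invFact c) ⟩
  2ℚ ℚ.* (sine a ℚ.* invFact a) ℚ.* (sine c ℚ.* invFact c)
    ≡⟨ cong₂ (λ x y → 2ℚ ℚ.* x ℚ.* y) (sym (sinS2overS2≡ a)) (sym (sinS2overS2≡ c)) ⟩
  2ℚ ℚ.* sinS2overS2 a ℚ.* sinS2overS2 c ∎
numSeries≡ a (suc b) c = sym (if-*³ false 0ℚ (invFact a) (invFact (suc b)) (invFact c))

theorem1p4 : (f : Seq) → IsDelta f →
    ∀ a b c → (lhsSeries f ⊛ denSeries) a b c ≡ numSeries a b c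
theorem1p4 f Δ a b c = begin
  (lhsSeries f ⊛ denSeries) a b c
    ≡⟨ ⊛-cong (lhsSeries≡ f Δ) denSeries≡ a b c ⟩
  (exponential U ⊛ exponential (𝟚 V.* cos²)) a b c
    ≡⟨ ⊛-exponential U (𝟚 V.* cos²) a b c ⟩
  exponential (U V.* (𝟚 V.* cos²)) a b c
    ≡⟨ cong (λ w → w ℚ.* invFact a ℚ.* invFact b ℚ.* invFact c) (One.at (Two.at (Three.at product b) a) c) ⟩
  exponential (λ b a c → 2ℚ ℚ.* Three.const (sx T.* sz) b a c) a b c
    ≡⟨ numSeries≡ a b c ⟩
  numSeries a b c ∎
  where
  open ClosedForm using (U)
  module T = ℚAlgebra Series₂
  module V = ℚAlgebra Series₃
  open Constants Series₃ using (𝟚)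
  open Solver Series₃ using (solve; _:=_; _:*_)
  product : U V.* (𝟚 V.* cos²) V.≈ (λ b a c → 2ℚ ℚ.* Three.const (sx T.* sz) b a c)
  product = V.trans (solve 3 (λ u t k → u :* (t :* k) := t :* (u :* k)) V.refl U 𝟚 cos²) (V.trans
    (V.*-congˡ {𝟚} U-cos²) (V.trans
    (Three.const⊙ (Two.const (One.const 2ℚ)) (Three.const (sx T.* sz)))
    (Three.pointwise λ b → T.trans (Two.const⊙ (One.const 2ℚ) (Three.const (sx T.* sz) b))
      (Two.pointwise λ a → One.const⊙ 2ℚ (Three.const (sx T.* sz) b a)))))
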